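{- Let $T$ denote the set of nonnegative integers for which the sum of any two consecutive digits in the base-$3$ expansion is always less than $3$, and let $T'=\{t\in T : t\not\equiv 2\pmod 3\}$. For every integer $n\ge 1$ there is $L_0$ such that for all integers $L\ge L_0$ the following hold. (i) (Case $p=2$.) $\nu_2(S(2^L+n-1,n))=[n/2]+\bar n-1$, where $\bar n\in\{0,1\}$ is the residue of $n$ mod $2$, if and only if $n=2^{\varepsilon}(2s+1)$ with $0\le \varepsilon\le 2$, $s\ge 0$ and $\binom{3s}{s}$ odd. (ii) (Case $p=3$.) $\nu_3(S(2\cdot 3^L+n-1,n))=2[n/3]+\bar n-1$, where $\bar n\in\{0,1,2\}$ is the residue of $n$ mod $3$, if and only if $n\in(3T+1)\cup(3T'+2)\cup(9T+3)$ and $n\not\equiv 2\pmod 9$. (iii) If $n=9x+2$ with $x\ge 0$ an integer, then $\nu_3(S(2\cdot 3^L+n-1,n+1))\ge 6x$, with equality if and only if $x\in T$.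
   Context: $S(k,j)$ is the Stirling number of the second kind. $\nu_p(m)$ is the exponent of the prime $p$ in $m$; $[x]$ is the integer part. For integers $a,b$ and a set $A$ of integers, $aA+b=\{at+b : t\in A\}$. Integers with a one-digit base-$3$ expansion satisfy the digit condition vacuously. -}

module Defs where

open import Data.Digit using (toDigits)
open import Data.Fin using (toℕ)
open import Data.List.Relation.Unary.Linked using (Linked)
open import Data.Nat
open import Data.Nat.Divisibility
open import Data.Nat.Properties
open import Data.Product using (∃; _×_; proj₁)
open import Level using (0ℓ)
open import Relation.Binary.PropositionalEquality using (_≡_; sym; subst)
open import Relation.Nullary using (¬_; yes; no)
open import Relation.Unary using (Pred; _∈_)

-- Stirling numbers of the second kind.  The recurrence says that element
-- k + 1 either joins one of the j + 1 blocks already present or forms a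
-- block of its own.
S : ℕ → ℕ → ℕ
S zero    zero    = 1
S zero    (suc j) = 0
S (suc k) zero    = 0
S (suc k) (suc j) = suc j * S k (suc j) + S k j

-- So ν below is never applied to 0 when it is applied to S k j, 1 ≤ j ≤ k.
S>0 : ∀ {k j} → 1 ≤ j → j ≤ k → 0 < S k j
S>0 {suc zero}    {suc zero}    _ _ = s≤s z≤n
S>0 {suc zero}    {suc (suc j)} _ (s≤s ())
S>0 {suc (suc k)} {suc zero}    _ _ =
  ≤-trans (S>0 {suc k} {1} (s≤s z≤n) (s≤s z≤n))
          (≤-trans (m≤m+n _ 0) (m≤m+n _ 0))
S>0 {suc (suc k)} {suc (suc j)} _ (s≤s j≤k) =
  ≤-trans (S>0 {suc k} {suc j} (s≤s z≤n) j≤k) (m≤n+m _ (suc (suc j) * S (suc k) (suc (suc j))))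

-- The exponent of p in m, by repeated division.  For p ≥ 2 each division
-- decreases a nonzero m, so m steps suffice (see ν-∣ and ν-∤).  The value
-- ν p 0 = 0 is junk.
ν-steps : (steps p m : ℕ) → ℕ
ν-steps zero        p m = 0
ν-steps (suc steps) p m with p ∣? m
... | yes p∣m = suc (ν-steps steps p (quotient p∣m))
... | no  _   = 0

ν : (p m : ℕ) → ℕ
ν p m = ν-steps m p m

private
  ν-steps-∣ : ∀ f p m → p ^ ν-steps f p m ∣ m
  ν-steps-∣ zero    p m = 1∣ m
  ν-steps-∣ (suc f) p m with p ∣? m
  ... | no  _             = 1∣ m
  ... | yes (divides q eq) =
    subst (p ^ suc (ν-steps f p q) ∣_) (sym eq)
      (subst (p ^ suc (ν-steps f p q) ∣_) (*-comm p q)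
        (*-monoʳ-∣ p (ν-steps-∣ f p q)))

  ν-steps-∤ : ∀ f p m .{{_ : NonTrivial p}} .{{_ : NonZero m}} → m ≤ f →
              p ^ suc (ν-steps f p m) ∤ m
  ν-steps-∤ zero    p (suc _) ()
  ν-steps-∤ (suc f) p m {{p>1}} m≤f d with p ∣? m
  ... | no  p∤m = p∤m (subst (_∣ m) (*-identityʳ p) d)
  ... | yes p∣m =
    ν-steps-∤ f p (quotient p∣m) {{p>1}} {{quotient≢0 p∣m}}
      (≤-pred (≤-trans (quotient-< p∣m) m≤f))
      (*-cancelˡ-∣ p {{nonTrivial⇒nonZero p}}
        (subst (p ^ suc (suc (ν-steps f p (quotient p∣m))) ∣_)
               (m∣n⇒n≡m*quotient p∣m) d))

ν-∣ : ∀ p m → p ^ ν p m ∣ m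
ν-∣ p m = ν-steps-∣ m p m

ν-∤ : ∀ p m .{{_ : NonTrivial p}} .{{_ : NonZero m}} → p ^ suc (ν p m) ∤ m
ν-∤ p m = ν-steps-∤ m p m ≤-refl

T : Pred ℕ 0ℓ
T t = Linked (λ d e → toℕ d + toℕ e < 3) (proj₁ (toDigits 3 t))

T′ : Pred ℕ 0ℓ
T′ t = t ∈ T × ¬ (t % 3 ≡ 2)

-- The set a A + b = { a t + b : t ∈ A }.
affine : ℕ → Pred ℕ 0ℓ → ℕ → Pred ℕ 0ℓ
affine a A b m = ∃ λ t → t ∈ A × m ≡ a * t + b

{-# OPTIONS --safe #-}
module Submission where

-- Let D be the difference operator f(y + 1) - f(y) on functions ℕ → ℤ, so that
-- N! S(k, N) = D^N(x^k)(0).  For k = (p - 1)p^L + q with q < N, y^k agrees with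
-- y^q modulo a high power of p when p ∤ y and is negligible when p ∣ y; since
-- D^N(x^q)(0) = 0 only -p^q D^N h(0) remains, where h(pj) = j^q and h is 0 off
-- the multiples of p.  With Δf(y) = f(y + p) - f(y) one has D^p = Δ - pZ for
-- p = 2, 3.  As Δ^a h is divisible by a! and p^b/b! is divisible by p for b > 0,
-- the binomial theorem gives D^(mp) h ≡ Δ^m h modulo the p-part of p·m!, and
-- Δ^m h is m! S(q, m) at 0.  For N = mp + r with r < p the result is
-- ν_p(S(k, N)) ≥ q - m, with equality iff p ∤ S(q, m).
--
-- Modulo 2 and 3 the columns of the Stirling triangle are binomial
-- coefficients, and Lucas' theorem turns their nonvanishing into
-- conditions on digits.

open import Defs
open import Data.Digit using (Digit; fromDigits; toDigits)
open import Data.Fin using (toℕ; zero; suc)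
open import Data.Fin.Properties using (toℕ<n)
open import Data.Integer.Base using (ℤ; +_; 0ℤ; 1ℤ)
  renaming (_+_ to _+ᶻ_; _*_ to _*ᶻ_; _-_ to _-ᶻ_; -_ to -ᶻ_; _^_ to _^ᶻ_)
open import Data.Integer.Divisibility.Signed using () renaming (_∣_ to _∣ᶻ_; divides to dividesᶻ)
import Data.Integer.Divisibility.Signed as ℤ∣
import Data.Integer.Properties as ℤ
open import Data.Integer.Tactic.RingSolver using () renaming (solve-∀ to solve-∀ᶻ)
open import Data.List using ([]; _∷_)
open import Data.List.Relation.Unary.Linked using (Linked; []; [-]; _∷_)
open import Data.Nat
open import Data.Nat.Combinatorics using (_C_; nCk+nC[k+1]≡[n+1]C[k+1]; nCn≡1)
open import Data.Nat.DivMod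
open import Data.Nat.Divisibility
open import Data.Nat.Induction using (<-rec)
open import Data.Nat.Primality using (Prime; prime?; euclidsLemma; prime⇒nonZero; prime⇒nonTrivial)
open import Data.Nat.Properties
open import Data.Nat.Tactic.RingSolver using (solve-∀)
open import Data.Product using (∃; _×_; _,_; proj₁; proj₂)
open import Data.Product.Function.NonDependent.Propositional using (_×-⇔_)
open import Data.Sum using (inj₁; inj₂; [_,_])
open import Function.Base using (_∘_)
open import Function.Bundles using (_⇔_; mk⇔; Equivalence)
open import Function.Properties.Equivalence using (⇔-setoid)
open import Level using (0ℓ)
open import Relation.Binary.Bundles using (Setoid)
open import Relation.Binary.PropositionalEquality hiding ([_])
import Relation.Binary.Reasoning.Setoid as SetoidReasoning
open import Relation.Nullary using (¬_; Dec; yes; no; contradiction)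
open import Relation.Nullary.Decidable using (from-yes)
open import Relation.Unary using (_∈_; _∪_)

-- The obstacle is the division by N!. For N = mp + r it is p^m · m! times a number prime to p, so
-- D^N h must be known modulo p times the p-part of m!. The factor p^b in the terms of the binomial
-- expansion does not reach that far by itself; the divisibility of Δ^a h by a! has to make up the
-- difference. Parts (i) and (ii) are N = n, q = n - 1, m = [n/p], where q - m = (p - 1)[n/p] + n̄ -
-- 1. Part (iii) is N = n + 1, q = n - 1 = 9x + 1, m = 3x + 1, where q - m = 6x. It remains to
-- decide when p divides S(n - 1, [n/p]) or S(9x + 1, 3x + 1). The set T arises as a no-carry
-- condition: digits of 3t and t in equal positions are consecutive digits of t, so t lies in T iff
-- 3t and t add in base 3 without a carry, that is, iff 3 does not divide C(4t, t). In base 2 the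
-- pair s, 2s gives C(3s, s) in the same way.

-- Binomial coefficients and Stirling numbers modulo a prime

-- bin a b is the binomial coefficient of a + b over a, in the symmetric form
-- in which Lucas' theorem needs no separate case for carries.
bin : ℕ → ℕ → ℕ
bin zero    b       = 1
bin (suc a) zero    = 1
bin (suc a) (suc b) = bin a (suc b) + bin (suc a) b

bin-zeroʳ : ∀ a → bin a 0 ≡ 1
bin-zeroʳ zero    = refl
bin-zeroʳ (suc a) = refl

bin-comm : ∀ a b → bin a b ≡ bin b a
bin-comm zero    b       = sym (bin-zeroʳ b)
bin-comm (suc a) zero    = refl
bin-comm (suc a) (suc b) =
  trans (cong₂ _+_ (bin-comm a (suc b)) (bin-comm (suc a) b)) (+-comm (bin (suc b) a) _)

C≡bin : ∀ a b → (a + b) C a ≡ bin a b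
C≡bin zero    b       = refl
C≡bin (suc a) zero    = trans (cong (_C suc a) (+-identityʳ (suc a))) (nCn≡1 (suc a))
C≡bin (suc a) (suc b) = begin
  suc (a + suc b) C suc a                    ≡⟨ nCk+nC[k+1]≡[n+1]C[k+1] (a + suc b) a ⟨
  (a + suc b) C a + (a + suc b) C suc a      ≡⟨ cong (λ x → (a + suc b) C a + x C suc a) (+-suc a b) ⟩
  (a + suc b) C a + suc (a + b) C suc a      ≡⟨ cong₂ _+_ (C≡bin a (suc b)) (C≡bin (suc a) b) ⟩
  bin a (suc b) + bin (suc a) b              ∎
  where open ≡-Reasoning

bin-! : ∀ a b → bin a b * (a ! * b !) ≡ (a + b) !
bin-! zero    b       = trans (+-identityʳ _) (+-identityʳ (b !))
bin-! (suc a) zero    = begin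
  1 * (suc a ! * 1)  ≡⟨ solve₁ (suc a !) ⟩
  suc a !            ≡⟨ cong _! (+-identityʳ (suc a)) ⟨
  (suc a + 0) !      ∎
  where
  open ≡-Reasoning
  solve₁ : ∀ x → 1 * (x * 1) ≡ x
  solve₁ = solve-∀
bin-! (suc a) (suc b) = begin
  (bin a (suc b) + bin (suc a) b) * (suc a ! * suc b !)
    ≡⟨ solve₁ a b (bin a (suc b)) (bin (suc a) b) (a !) (b !) ⟩
  suc a * (bin a (suc b) * (a ! * suc b !)) + suc b * (bin (suc a) b * (suc a ! * b !))
    ≡⟨ cong₂ (λ x y → suc a * x + suc b * y) (bin-! a (suc b)) (bin-! (suc a) b) ⟩
  suc a * (a + suc b) ! + suc b * suc (a + b) !
    ≡⟨ cong (λ x → suc a * (a + suc b) ! + suc b * x !) (+-suc a b) ⟨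
  suc a * (a + suc b) ! + suc b * (a + suc b) !
    ≡⟨ *-distribʳ-+ ((a + suc b) !) (suc a) (suc b) ⟨
  (suc a + suc b) * (a + suc b) !
    ∎
  where
  open ≡-Reasoning
  solve₁ : ∀ a b x y u v → (x + y) * (((1 + a) * u) * ((1 + b) * v))
         ≡ (1 + a) * (x * (u * ((1 + b) * v))) + (1 + b) * (y * (((1 + a) * u) * v))
  solve₁ = solve-∀

bin-absorb : ∀ a b → suc b * bin a (suc b) ≡ suc a * bin (suc a) b
bin-absorb a b = *-cancelʳ-≡ _ _ (a ! * b !) {{m*n≢0 (a !) (b !) {{a !≢0}} {{b !≢0}}}} (begin
  suc b * bin a (suc b) * (a ! * b !)    ≡⟨ solve₁ b (bin a (suc b)) (a !) (b !) ⟩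
  bin a (suc b) * (a ! * suc b !)        ≡⟨ bin-! a (suc b) ⟩
  (a + suc b) !                          ≡⟨ cong _! (+-suc a b) ⟩
  (suc a + b) !                          ≡⟨ bin-! (suc a) b ⟨
  bin (suc a) b * (suc a ! * b !)        ≡⟨ solve₂ a (bin (suc a) b) (a !) (b !) ⟩
  suc a * bin (suc a) b * (a ! * b !)    ∎)
  where
  open ≡-Reasoning
  solve₁ : ∀ b x u v → (1 + b) * x * (u * v) ≡ x * (u * ((1 + b) * v))
  solve₁ = solve-∀
  solve₂ : ∀ a x u v → x * (((1 + a) * u) * v) ≡ (1 + a) * x * (u * v)
  solve₂ = solve-∀

-- Congruences and Lucas' theorem

module Mod (p : ℕ) .{{_ : NonZero p}} where

  infix 4 _≈_

  -- A record rather than a bare equation of remainders, so that `x` and `y` can be inferred from a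
  -- congruence: `x % p` does not determine `x`.
  record _≈_ (x y : ℕ) : Set where
    constructor mk≈
    field %-≡ : x % p ≡ y % p

  open _≈_

  ≈-refl : ∀ {x} → x ≈ x
  ≈-refl = mk≈ refl

  ≈-reflexive : ∀ {x y} → x ≡ y → x ≈ y
  ≈-reflexive refl = ≈-refl

  ≈-setoid : Setoid _ _
  ≈-setoid = record
    { _≈_ = _≈_
    ; isEquivalence = record
      { refl  = ≈-refl
      ; sym   = λ (mk≈ e) → mk≈ (sym e)
      ; trans = λ (mk≈ e) (mk≈ f) → mk≈ (trans e f)
      }
    }

  open Setoid ≈-setoid public using () renaming (sym to ≈-sym; trans to ≈-trans)
  module ≈-Reasoning = SetoidReasoning ≈-setoid

  +-cong : ∀ {x y u v} → x ≈ y → u ≈ v → x + u ≈ y + v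
  +-cong {x} {y} {u} {v} (mk≈ e) (mk≈ f) = mk≈
    (trans (%-distribˡ-+ x u p) (trans (cong₂ (λ a b → (a + b) % p) e f) (sym (%-distribˡ-+ y v p))))

  *-cong : ∀ {x y u v} → x ≈ y → u ≈ v → x * u ≈ y * v
  *-cong {x} {y} {u} {v} (mk≈ e) (mk≈ f) = mk≈
    (trans (%-distribˡ-* x u p) (trans (cong₂ (λ a b → (a * b) % p) e f) (sym (%-distribˡ-* y v p))))

  +-mult : ∀ x y → x + y * p ≈ x
  +-mult x y = mk≈ ([m+kn]%n≡m%n x y p)

  ∣⇒≈0 : ∀ {x} → p ∣ x → x ≈ 0
  ∣⇒≈0 {x} d = mk≈ (trans (n∣m⇒m%n≡0 x p d) (sym (m<n⇒m%n≡m (>-nonZero⁻¹ p))))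

  ∣-resp : ∀ {x y} → x ≈ y → p ∣ x → p ∣ y
  ∣-resp {x} {y} (mk≈ e) d = m%n≡0⇒n∣m y p (trans (sym e) (n∣m⇒m%n≡0 x p d))

  ∤-resp : ∀ {x y} → x ≈ y → p ∤ x ⇔ p ∤ y
  ∤-resp e = mk⇔ (_∘ ∣-resp (≈-sym e)) (_∘ ∣-resp e)

0<i<p⇒p∤i : ∀ {p i} → 0 < i → i < p → p ∤ i
0<i<p⇒p∤i 0<i i<p d = <⇒≱ i<p (∣⇒≤ {{>-nonZero 0<i}} d)

-- Cut Pascal's triangle mod p into p × p blocks.  In the last row and the last
-- column of a block only one entry survives, so the blocks satisfy Pascal's
-- recursion themselves and each is a multiple of the first one.
module Lucas (e : ℕ) (p-prime : Prime (suc e)) where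

  private p = suc e

  open Mod p

  -- Absorption gives (j + 1) · bin e (j + 1) = p · bin p j, and p cannot divide j + 1.
  p∣bin-row : ∀ j → suc j < p → p ∣ bin e (suc j)
  p∣bin-row j j<p with euclidsLemma (suc j) (bin e (suc j)) p-prime
                         (divides (bin p j) (trans (bin-absorb e j) (*-comm p _)))
  ... | inj₁ d = contradiction d (0<i<p⇒p∤i z<s j<p)
  ... | inj₂ d = d

  lucas : ∀ a b i j → i < p → j < p → bin (i + a * p) (j + b * p) ≈ bin a b * bin i j
  lucas zero    b       zero    zero    _   _   = ≈-refl
  lucas (suc a) zero    zero    zero    _   _   = ≈-refl
  lucas (suc a) (suc b) zero    zero    _   _   = begin
    bin (e + a * p) (p + b * p) + bin (p + a * p) (e + b * p)
      ≈⟨ +-cong (lucas a (suc b) e 0 ≤-refl z<s) (lucas (suc a) b 0 e z<s ≤-refl) ⟩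
    bin a (suc b) * bin e 0 + bin (suc a) b * 1
      ≡⟨ cong (λ x → bin a (suc b) * x + bin (suc a) b * 1) (bin-zeroʳ e) ⟩
    bin a (suc b) * 1 + bin (suc a) b * 1
      ≡⟨ *-distribʳ-+ 1 (bin a (suc b)) _ ⟨
    (bin a (suc b) + bin (suc a) b) * 1
      ∎
    where open ≈-Reasoning
  lucas zero    b       zero    (suc j) _   _   = ≈-refl
  lucas (suc a) b       zero    (suc j) _   j<p = begin
    bin (e + a * p) (suc j + b * p) + bin (p + a * p) (j + b * p)
      ≈⟨ +-cong (lucas a b e (suc j) ≤-refl j<p) (lucas (suc a) b 0 j z<s (<⇒≤ j<p)) ⟩
    bin a b * bin e (suc j) + bin (suc a) b * 1
      ≈⟨ +-cong (∣⇒≈0 (∣n⇒∣m*n (bin a b) (p∣bin-row j j<p))) ≈-refl ⟩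
    bin (suc a) b * 1
      ∎
    where open ≈-Reasoning
  lucas a       zero    (suc i) zero    _   _   =
    ≈-reflexive (sym (trans (*-identityʳ _) (bin-zeroʳ a)))
  lucas a       (suc b) (suc i) zero    i<p _   = begin
    bin (i + a * p) (p + b * p) + bin (suc i + a * p) (e + b * p)
      ≈⟨ +-cong (lucas a (suc b) i 0 (<⇒≤ i<p) z<s) (lucas a b (suc i) e i<p ≤-refl) ⟩
    bin a (suc b) * bin i 0 + bin a b * bin (suc i) e
      ≡⟨ cong₂ (λ x y → bin a (suc b) * x + bin a b * y) (bin-zeroʳ i) (bin-comm (suc i) e) ⟩
    bin a (suc b) * 1 + bin a b * bin e (suc i)
      ≈⟨ +-cong ≈-refl (∣⇒≈0 (∣n⇒∣m*n (bin a b) (p∣bin-row i i<p))) ⟩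
    bin a (suc b) * 1 + 0
      ≡⟨ +-identityʳ _ ⟩
    bin a (suc b) * 1
      ∎
    where open ≈-Reasoning
  lucas a       b       (suc i) (suc j) i<p j<p = begin
    bin (i + a * p) (suc j + b * p) + bin (suc i + a * p) (j + b * p)
      ≈⟨ +-cong (lucas a b i (suc j) (<⇒≤ i<p) j<p) (lucas a b (suc i) j i<p (<⇒≤ j<p)) ⟩
    bin a b * bin i (suc j) + bin a b * bin (suc i) j
      ≡⟨ *-distribˡ-+ (bin a b) (bin i (suc j)) _ ⟨
    bin a b * (bin i (suc j) + bin (suc i) j)
      ∎
    where open ≈-Reasoning

  bin-below-diagonal : ∀ c → bin (suc c) (e + c * p) ≡ bin c (suc c * p) * p
  bin-below-diagonal c = *-cancelˡ-≡ _ _ (suc c) (begin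
    suc c * bin (suc c) (e + c * p)    ≡⟨ bin-absorb c (e + c * p) ⟨
    suc c * p * bin c (suc c * p)      ≡⟨ solve₁ (suc c) p (bin c (suc c * p)) ⟩
    suc c * (bin c (suc c * p) * p)    ∎)
    where
    open ≡-Reasoning
    solve₁ : ∀ c p x → c * p * x ≡ c * (x * p)
    solve₁ = solve-∀

  -- With b = (c + 1)p the quotient of the two sides is (c + 1 + b)/(c + 1) = 1 + p. This repairs a
  -- shift: Stirling columns whose index is a multiple of p yield `bin c`, while the digit
  -- conditions speak of `bin (suc c)`.
  bin-diagonal : ∀ c → bin (suc c) (suc c * p) ≈ bin c (suc c * p)
  bin-diagonal c = begin
    bin c (suc c * p) + bin (suc c) (e + c * p)
      ≡⟨ cong (λ x → bin c (suc c * p) + x) (bin-below-diagonal c) ⟩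
    bin c (suc c * p) + bin c (suc c * p) * p
      ≈⟨ +-mult _ (bin c (suc c * p)) ⟩
    bin c (suc c * p)
      ∎
    where open ≈-Reasoning

-- Columns of the Stirling triangle modulo 2 and 3

S≡0 : ∀ {k j} → k < j → S k j ≡ 0
S≡0 {zero}  {suc j} _         = refl
S≡0 {suc k} {suc j} (s≤s k<j) =
  cong₂ _+_ (trans (cong (suc j *_) (S≡0 (m<n⇒m<1+n k<j))) (*-zeroʳ (suc j))) (S≡0 k<j)

S-diagonal : ∀ j → S j j ≡ 1
S-diagonal zero    = refl
S-diagonal (suc j) =
  cong₂ _+_ (trans (cong (suc j *_) (S≡0 (n<1+n j))) (*-zeroʳ (suc j))) (S-diagonal j)

-- The entry at distance `s` from the diagonal, which is the coefficient of x^s in 1/((1 - x)(1 -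
-- 2x)⋯(1 - jx)).
col : ℕ → ℕ → ℕ
col j s = S (s + j) j

col-suc : ∀ j s → col (suc j) (suc s) ≡ suc j * col (suc j) s + col j (suc s)
col-suc j s = cong (λ k → suc j * S (s + suc j) (suc j) + S k j) (+-suc s j)

-- Modulo p the generating function of column j is x^j over a power of
-- (1 - x)(1 - 2x)⋯(1 - (p-1)x), which is 1 - x for p = 2 and 1 - x² for p = 3.
module Columns₂ where

  open Mod 2
  open ≈-Reasoning

  col-odd : ∀ c s → col (1 + c * 2) s ≈ bin c s
  col-even : ∀ c s → col (2 + c * 2) s ≈ bin c s

  col-odd c zero = begin
    col (1 + c * 2) 0  ≡⟨ S-diagonal (1 + c * 2) ⟩
    1                  ≡⟨ bin-zeroʳ c ⟨
    bin c 0            ∎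
  col-odd zero (suc s) = begin
    col 1 (suc s)      ≡⟨ col-suc 0 s ⟩
    1 * col 1 s + 0    ≈⟨ +-cong (*-cong (≈-refl {1}) (col-odd 0 s)) (≈-refl {0}) ⟩
    1                  ∎
  col-odd (suc c) (suc s) = begin
    col (3 + c * 2) (suc s)
      ≡⟨ col-suc (2 + c * 2) s ⟩
    (1 + suc c * 2) * col (3 + c * 2) s + col (2 + c * 2) (suc s)
      ≈⟨ +-cong (*-cong (+-mult 1 (suc c)) (col-odd (suc c) s)) (col-even c (suc s)) ⟩
    1 * bin (suc c) s + bin c (suc s)
      ≡⟨ trans (cong (_+ bin c (suc s)) (*-identityˡ _)) (+-comm _ (bin c (suc s))) ⟩
    bin (suc c) (suc s)
      ∎

  col-even c zero = begin
    col (2 + c * 2) 0  ≡⟨ S-diagonal (2 + c * 2) ⟩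
    1                  ≡⟨ bin-zeroʳ c ⟨
    bin c 0            ∎
  col-even c (suc s) = begin
    col (2 + c * 2) (suc s)
      ≡⟨ col-suc (1 + c * 2) s ⟩
    (0 + suc c * 2) * col (2 + c * 2) s + col (1 + c * 2) (suc s)
      ≈⟨ +-cong (*-cong (+-mult 0 (suc c)) (≈-refl {col (2 + c * 2) s})) (col-odd c (suc s)) ⟩
    bin c (suc s)
      ∎

module Columns₃ where

  open Mod 3
  open ≈-Reasoning

  -- The series of `col (1 + c * 3)` is 1/((1 - x²)^c (1 - x)) = (1 + x)/(1 - x²)^(c + 1), so
  -- neighbouring even and odd coefficients agree. The next factor 1 - 2x ≡ 1 + x cancels the
  -- numerator and leaves a series in x²; the factor 1 - 3x ≡ 1 changes nothing.
  col₁-even : ∀ c t → col (1 + c * 3) (t * 2)     ≈ bin c t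
  col₁-odd  : ∀ c t → col (1 + c * 3) (1 + t * 2) ≈ bin c t
  col₂-even : ∀ c t → col (2 + c * 3) (t * 2)     ≈ bin c t
  col₂-odd  : ∀ c t → col (2 + c * 3) (1 + t * 2) ≈ 0
  col₃-even : ∀ c t → col (3 + c * 3) (t * 2)     ≈ bin c t
  col₃-odd  : ∀ c t → col (3 + c * 3) (1 + t * 2) ≈ 0

  col₁-even c zero = begin
    col (1 + c * 3) 0  ≡⟨ S-diagonal (1 + c * 3) ⟩
    1                  ≡⟨ bin-zeroʳ c ⟨
    bin c 0            ∎
  col₁-even zero (suc t) = begin
    col 1 (2 + t * 2)          ≡⟨ col-suc 0 (1 + t * 2) ⟩
    1 * col 1 (1 + t * 2) + 0  ≈⟨ +-cong (*-cong (≈-refl {1}) (col₁-odd 0 t)) (≈-refl {0}) ⟩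
    1                          ∎
  col₁-even (suc c) (suc t) = begin
    col (4 + c * 3) (2 + t * 2)
      ≡⟨ col-suc (3 + c * 3) (1 + t * 2) ⟩
    (1 + suc c * 3) * col (4 + c * 3) (1 + t * 2) + col (3 + c * 3) (2 + t * 2)
      ≈⟨ +-cong (*-cong (+-mult 1 (suc c)) (col₁-odd (suc c) t)) (col₃-even c (suc t)) ⟩
    1 * bin (suc c) t + bin c (suc t)
      ≡⟨ trans (cong (_+ bin c (suc t)) (*-identityˡ _)) (+-comm _ (bin c (suc t))) ⟩
    bin (suc c) (suc t)
      ∎

  col₁-odd zero t = begin
    col 1 (1 + t * 2)      ≡⟨ col-suc 0 (t * 2) ⟩
    1 * col 1 (t * 2) + 0  ≈⟨ +-cong (*-cong (≈-refl {1}) (col₁-even 0 t)) (≈-refl {0}) ⟩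
    1                      ∎
  col₁-odd (suc c) t = begin
    col (4 + c * 3) (1 + t * 2)
      ≡⟨ col-suc (3 + c * 3) (t * 2) ⟩
    (1 + suc c * 3) * col (4 + c * 3) (t * 2) + col (3 + c * 3) (1 + t * 2)
      ≈⟨ +-cong (*-cong (+-mult 1 (suc c)) (col₁-even (suc c) t)) (col₃-odd c t) ⟩
    1 * bin (suc c) t + 0
      ≡⟨ trans (+-identityʳ _) (*-identityˡ _) ⟩
    bin (suc c) t
      ∎

  col₂-even c zero = begin
    col (2 + c * 3) 0  ≡⟨ S-diagonal (2 + c * 3) ⟩
    1                  ≡⟨ bin-zeroʳ c ⟨
    bin c 0            ∎
  col₂-even c (suc t) = begin
    col (2 + c * 3) (2 + t * 2)
      ≡⟨ col-suc (1 + c * 3) (1 + t * 2) ⟩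
    (2 + c * 3) * col (2 + c * 3) (1 + t * 2) + col (1 + c * 3) (2 + t * 2)
      ≈⟨ +-cong (*-cong (+-mult 2 c) (col₂-odd c t)) (col₁-even c (suc t)) ⟩
    bin c (suc t)
      ∎

  col₂-odd c t = begin
    col (2 + c * 3) (1 + t * 2)
      ≡⟨ col-suc (1 + c * 3) (t * 2) ⟩
    (2 + c * 3) * col (2 + c * 3) (t * 2) + col (1 + c * 3) (1 + t * 2)
      ≈⟨ +-cong (*-cong (+-mult 2 c) (col₂-even c t)) (col₁-odd c t) ⟩
    2 * bin c t + bin c t
      ≡⟨ solve₁ (bin c t) ⟩
    bin c t * 3
      ≈⟨ +-mult 0 (bin c t) ⟩
    0
      ∎
    where
    solve₁ : ∀ x → 2 * x + x ≡ x * 3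
    solve₁ = solve-∀

  col₃-even c zero = begin
    col (3 + c * 3) 0  ≡⟨ S-diagonal (3 + c * 3) ⟩
    1                  ≡⟨ bin-zeroʳ c ⟨
    bin c 0            ∎
  col₃-even c (suc t) = begin
    col (3 + c * 3) (2 + t * 2)
      ≡⟨ col-suc (2 + c * 3) (1 + t * 2) ⟩
    (0 + suc c * 3) * col (3 + c * 3) (1 + t * 2) + col (2 + c * 3) (2 + t * 2)
      ≈⟨ +-cong (*-cong (+-mult 0 (suc c)) (≈-refl {col (3 + c * 3) (1 + t * 2)})) (col₂-even c (suc t)) ⟩
    bin c (suc t)
      ∎

  col₃-odd c t = begin
    col (3 + c * 3) (1 + t * 2)
      ≡⟨ col-suc (2 + c * 3) (t * 2) ⟩
    (0 + suc c * 3) * col (3 + c * 3) (t * 2) + col (2 + c * 3) (1 + t * 2)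
      ≈⟨ +-cong (*-cong (+-mult 0 (suc c)) (≈-refl {col (3 + c * 3) (t * 2)})) (col₂-odd c t) ⟩
    0
      ∎

-- Digit conditions for Stirling numbers prime to 3 or to 2

module ⇔-Reasoning = SetoidReasoning (⇔-setoid 0ℓ)
open Setoid (⇔-setoid 0ℓ) using () renaming (refl to ⇔-refl; sym to ⇔-sym; trans to ⇔-trans)
open Equivalence using (to; from)

∤-*⇔ : ∀ {p} → Prime p → ∀ x y → p ∤ x * y ⇔ (p ∤ x × p ∤ y)
∤-*⇔ p-prime x y = mk⇔
  (λ h → (λ d → h (∣m⇒∣m*n y d)) , (λ d → h (∣n⇒∣m*n x d)))
  (λ (p∤x , p∤y) d → [ p∤x , p∤y ] (euclidsLemma x y p-prime d))

2-prime : Prime 2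
2-prime = from-yes (prime? 2)

3-prime : Prime 3
3-prime = from-yes (prime? 3)

module Ternary where

  open Lucas 2 3-prime
  open Mod 3

  NoCarry : Digit 3 → Digit 3 → Set
  NoCarry d e = toℕ d + toℕ e < 3

  noCarry⇔ : ∀ d e → NoCarry d e ⇔ 3 ∤ bin (toℕ d) (toℕ e)
  noCarry⇔ zero             e                = mk⇔ (λ _ → 0<i<p⇒p∤i z<s (s<s z<s)) (λ _ → toℕ<n e)
  noCarry⇔ (suc zero)       zero             = mk⇔ (λ _ → 0<i<p⇒p∤i z<s (s<s z<s)) (λ _ → s<s z<s)
  noCarry⇔ (suc zero)       (suc zero)       = mk⇔ (λ _ → 0<i<p⇒p∤i z<s ≤-refl) (λ _ → ≤-refl)
  noCarry⇔ (suc zero)       (suc (suc zero)) = mk⇔ (λ { (s<s (s<s (s<s ()))) }) (contradiction ∣-refl)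
  noCarry⇔ (suc (suc zero)) zero             = mk⇔ (λ _ → 0<i<p⇒p∤i z<s (s<s z<s)) (λ _ → ≤-refl)
  noCarry⇔ (suc (suc zero)) (suc zero)       = mk⇔ (λ { (s<s (s<s (s<s ()))) }) (contradiction ∣-refl)
  noCarry⇔ (suc (suc zero)) (suc (suc zero)) = mk⇔ (λ { (s<s (s<s (s<s ()))) }) (contradiction (divides 2 refl))

  -- Digits are listed from the least significant, so `fromDigits ds` is the number with its last
  -- digit removed, and digits in equal positions of the two arguments of `bin` are consecutive
  -- digits of the number. Lucas' theorem turns each such pair into one factor.
  linked-∷⇔ : ∀ d ds → Linked NoCarry (d ∷ ds) ⇔ 3 ∤ bin (toℕ d + fromDigits ds * 3) (fromDigits ds)
  linked-∷⇔ d []       = mk⇔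
    (λ _ → 0<i<p⇒p∤i z<s (s<s z<s) ∘ subst (3 ∣_) (bin-zeroʳ (toℕ d + 0))) (λ _ → [-])
  linked-∷⇔ d (e ∷ ds) = begin
    Linked NoCarry (d ∷ e ∷ ds)
      ≈⟨ mk⇔ (λ { (r ∷ l) → l , r }) (λ (l , r) → r ∷ l) ⟩
    (Linked NoCarry (e ∷ ds) × NoCarry d e)
      ≈⟨ linked-∷⇔ e ds ×-⇔ noCarry⇔ d e ⟩
    (3 ∤ bin f f′ × 3 ∤ bin (toℕ d) (toℕ e))
      ≈⟨ ∤-*⇔ 3-prime (bin f f′) (bin (toℕ d) (toℕ e)) ⟨
    3 ∤ bin f f′ * bin (toℕ d) (toℕ e)
      ≈⟨ ∤-resp (lucas f f′ (toℕ d) (toℕ e) (toℕ<n d) (toℕ<n e)) ⟨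
    3 ∤ bin (toℕ d + f * 3) f
      ∎
    where
    open ⇔-Reasoning
    f′ = fromDigits ds
    f  = toℕ e + f′ * 3

  -- Multiplication by 3 pairs the last digit `a` with 0, and this pair contributes the factor 1.
  T-cons-bin : ∀ a c → a < 3 → 3 ∤ bin ((a + c * 3) * 3) (a + c * 3) ⇔ 3 ∤ bin (a + c * 3) c
  T-cons-bin a c a<3 = ∤-resp (≈-trans (lucas (a + c * 3) c 0 a z<s a<3) (≈-reflexive (*-identityʳ _)))

  linked⇔ : ∀ ds → Linked NoCarry ds ⇔ 3 ∤ bin (fromDigits ds * 3) (fromDigits ds)
  linked⇔ []       = mk⇔ (λ _ → 0<i<p⇒p∤i z<s (s<s z<s)) (λ _ → [])
  linked⇔ (d ∷ ds) = ⇔-trans (linked-∷⇔ d ds) (⇔-sym (T-cons-bin (toℕ d) (fromDigits ds) (toℕ<n d)))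

  T⇔bin : ∀ t → T t ⇔ 3 ∤ bin (t * 3) t
  T⇔bin t with toDigits 3 t
  ... | ds , refl = linked⇔ ds

  T-cons⇔bin : ∀ a c → a < 3 → T (a + c * 3) ⇔ 3 ∤ bin (a + c * 3) c
  T-cons⇔bin a c a<3 = ⇔-trans (T⇔bin (a + c * 3)) (T-cons-bin a c a<3)

  open Columns₃
  open ⇔-Reasoning

  3∤S[3m,m]⇔ : ∀ m → 3 ∤ S (m * 3) m ⇔ T m
  3∤S[3m,m]⇔ m = go (m divMod 3)
    where
    go : ∀ {m} → DivMod m 3 → 3 ∤ S (m * 3) m ⇔ T m
    -- Column 0 is outside the three families of `Columns₃`; here both Stirling number and binomial
    -- coefficient are 1.
    go (result zero zero refl) =
      ⇔-sym (T⇔bin 0)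
    go (result (suc c) zero refl) = begin
      3 ∤ S ((3 + c * 3) * 3) (3 + c * 3)          ≡⟨ cong (λ k → 3 ∤ S k (3 + c * 3)) (solve₁ c) ⟩
      3 ∤ col (3 + c * 3) ((3 + c * 3) * 2)        ≈⟨ ∤-resp (col₃-even c (3 + c * 3)) ⟩
      3 ∤ bin c (3 + c * 3)                        ≈⟨ ∤-resp (bin-diagonal c) ⟨
      3 ∤ bin (suc c) (3 + c * 3)                  ≡⟨ cong (3 ∤_) (bin-comm (suc c) _) ⟩
      3 ∤ bin (3 + c * 3) (suc c)                  ≈⟨ T-cons⇔bin 0 (suc c) z<s ⟨
      T (3 + c * 3)                                ∎
      where
      solve₁ : ∀ c → (3 + c * 3) * 3 ≡ (3 + c * 3) * 2 + (3 + c * 3)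
      solve₁ = solve-∀
    go (result c (suc zero) refl) = begin
      3 ∤ S ((1 + c * 3) * 3) (1 + c * 3)          ≡⟨ cong (λ k → 3 ∤ S k (1 + c * 3)) (solve₁ c) ⟩
      3 ∤ col (1 + c * 3) ((1 + c * 3) * 2)        ≈⟨ ∤-resp (col₁-even c (1 + c * 3)) ⟩
      3 ∤ bin c (1 + c * 3)                        ≡⟨ cong (3 ∤_) (bin-comm c _) ⟩
      3 ∤ bin (1 + c * 3) c                        ≈⟨ T-cons⇔bin 1 c (s<s z<s) ⟨
      T (1 + c * 3)                                ∎
      where
      solve₁ : ∀ c → (1 + c * 3) * 3 ≡ (1 + c * 3) * 2 + (1 + c * 3)
      solve₁ = solve-∀
    go (result c (suc (suc zero)) refl) = begin
      3 ∤ S ((2 + c * 3) * 3) (2 + c * 3)          ≡⟨ cong (λ k → 3 ∤ S k (2 + c * 3)) (solve₁ c) ⟩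
      3 ∤ col (2 + c * 3) ((2 + c * 3) * 2)        ≈⟨ ∤-resp (col₂-even c (2 + c * 3)) ⟩
      3 ∤ bin c (2 + c * 3)                        ≡⟨ cong (3 ∤_) (bin-comm c _) ⟩
      3 ∤ bin (2 + c * 3) c                        ≈⟨ T-cons⇔bin 2 c ≤-refl ⟨
      T (2 + c * 3)                                ∎
      where
      solve₁ : ∀ c → (2 + c * 3) * 3 ≡ (2 + c * 3) * 2 + (2 + c * 3)
      solve₁ = solve-∀

  ∤0 : ∀ {x} {A : Set} → x ≈ 0 → 3 ∤ x → A
  ∤0 e = contradiction (∣-resp (≈-sym e) (3 ∣0))

  -- The distance 2m + 1 from the diagonal is odd, and modulo 3 only columns of index 1 mod 3 are
  -- nonzero at odd distances.
  3∤S[3m+1,m]⇔ : ∀ m → 3 ∤ S (1 + m * 3) m ⇔ (T m × m % 3 ≡ 1)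
  3∤S[3m+1,m]⇔ m = go (m divMod 3)
    where
    go : ∀ {m} → DivMod m 3 → 3 ∤ S (1 + m * 3) m ⇔ (T m × m % 3 ≡ 1)
    go (result zero zero refl) = mk⇔ (contradiction (3 ∣0)) (λ { (_ , ()) })
    go (result (suc c) zero refl) = mk⇔
      (∤0 (subst (λ k → S k (3 + c * 3) ≈ 0) (solve₁ c) (col₃-odd c (3 + c * 3))))
      (λ (_ , eq) → contradiction (trans (sym ([m+kn]%n≡m%n 0 (suc c) 3)) eq) λ ())
      where
      solve₁ : ∀ c → 1 + (3 + c * 3) * 2 + (3 + c * 3) ≡ 1 + (3 + c * 3) * 3
      solve₁ = solve-∀
    go (result c (suc zero) refl) = begin
      3 ∤ S (1 + (1 + c * 3) * 3) (1 + c * 3)      ≡⟨ cong (λ k → 3 ∤ S k (1 + c * 3)) (solve₁ c) ⟩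
      3 ∤ col (1 + c * 3) (1 + (1 + c * 3) * 2)    ≈⟨ ∤-resp (col₁-odd c (1 + c * 3)) ⟩
      3 ∤ bin c (1 + c * 3)                        ≡⟨ cong (3 ∤_) (bin-comm c _) ⟩
      3 ∤ bin (1 + c * 3) c                        ≈⟨ T-cons⇔bin 1 c (s<s z<s) ⟨
      T (1 + c * 3)                                ≈⟨ mk⇔ (_, [m+kn]%n≡m%n 1 c 3) proj₁ ⟩
      (T (1 + c * 3) × (1 + c * 3) % 3 ≡ 1)        ∎
      where
      solve₁ : ∀ c → 1 + (1 + c * 3) * 3 ≡ 1 + (1 + c * 3) * 2 + (1 + c * 3)
      solve₁ = solve-∀
    go (result c (suc (suc zero)) refl) = mk⇔
      (∤0 (subst (λ k → S k (2 + c * 3) ≈ 0) (solve₁ c) (col₂-odd c (2 + c * 3))))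
      (λ (_ , eq) → contradiction (trans (sym ([m+kn]%n≡m%n 2 c 3)) eq) λ ())
      where
      solve₁ : ∀ c → 1 + (2 + c * 3) * 2 + (2 + c * 3) ≡ 1 + (2 + c * 3) * 3
      solve₁ = solve-∀

  3∤S[9t+1,3t+1]⇔ : ∀ t → 3 ∤ S (1 + t * 9) (1 + t * 3) ⇔ T t
  3∤S[9t+1,3t+1]⇔ t = begin
    3 ∤ S (1 + t * 9) (1 + t * 3)                ≡⟨ cong (λ k → 3 ∤ S k (1 + t * 3)) (solve₁ t) ⟩
    3 ∤ col (1 + t * 3) (t * 3 * 2)              ≈⟨ ∤-resp (col₁-even t (t * 3)) ⟩
    3 ∤ bin t (t * 3)                            ≡⟨ cong (3 ∤_) (bin-comm t _) ⟩
    3 ∤ bin (t * 3) t                            ≈⟨ T⇔bin t ⟨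
    T t                                          ∎
    where
    solve₁ : ∀ t → 1 + t * 9 ≡ t * 3 * 2 + (1 + t * 3)
    solve₁ = solve-∀

  3∤S[9t+2,3t+1]⇔ : ∀ t → 3 ∤ S (2 + t * 9) (1 + t * 3) ⇔ T t
  3∤S[9t+2,3t+1]⇔ t = begin
    3 ∤ S (2 + t * 9) (1 + t * 3)                ≡⟨ cong (λ k → 3 ∤ S k (1 + t * 3)) (solve₁ t) ⟩
    3 ∤ col (1 + t * 3) (1 + t * 3 * 2)          ≈⟨ ∤-resp (col₁-odd t (t * 3)) ⟩
    3 ∤ bin t (t * 3)                            ≡⟨ cong (3 ∤_) (bin-comm t _) ⟩
    3 ∤ bin (t * 3) t                            ≈⟨ T⇔bin t ⟨
    T t                                          ∎
    where
    solve₁ : ∀ t → 2 + t * 9 ≡ 1 + t * 3 * 2 + (1 + t * 3)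
    solve₁ = solve-∀

  -- The distance is again 2m + 1, but the column is m + 1, so a nonzero residue forces m = 3t. With
  -- n = 3m + 3 this is the origin of 9T + 3.
  3∤S[3m+2,m+1]⇔ : ∀ m → 3 ∤ S (2 + m * 3) (suc m) ⇔ (∃ λ t → T t × m ≡ t * 3)
  3∤S[3m+2,m+1]⇔ m = go (m divMod 3)
    where
    go : ∀ {m} → DivMod m 3 → 3 ∤ S (2 + m * 3) (suc m) ⇔ (∃ λ t → T t × m ≡ t * 3)
    go (result t zero refl) = begin
      3 ∤ S (2 + t * 3 * 3) (1 + t * 3)            ≡⟨ cong (λ k → 3 ∤ S (2 + k) (1 + t * 3)) (*-assoc t 3 3) ⟩
      3 ∤ S (2 + t * 9) (1 + t * 3)                ≈⟨ 3∤S[9t+2,3t+1]⇔ t ⟩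
      T t                                          ≈⟨ mk⇔ (λ h → t , h , refl)
                                                        (λ { (u , h , eq) → subst T (*-cancelʳ-≡ u t 3 (sym eq)) h }) ⟩
      (∃ λ u → T u × t * 3 ≡ u * 3)                ∎
    go (result c (suc zero) refl) = mk⇔
      (∤0 (subst (λ k → S k (2 + c * 3) ≈ 0) (solve₁ c) (col₂-odd c (1 + c * 3))))
      (λ (t , _ , eq) → contradiction (trans (sym ([m+kn]%n≡m%n 1 c 3)) (trans (cong (_% 3) eq) ([m+kn]%n≡m%n 0 t 3))) λ ())
      where
      solve₁ : ∀ c → 1 + (1 + c * 3) * 2 + (2 + c * 3) ≡ 2 + (1 + c * 3) * 3
      solve₁ = solve-∀
    go (result c (suc (suc zero)) refl) = mk⇔
      (∤0 (subst (λ k → S k (3 + c * 3) ≈ 0) (solve₁ c) (col₃-odd c (2 + c * 3))))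
      (λ (t , _ , eq) → contradiction (trans (sym ([m+kn]%n≡m%n 2 c 3)) (trans (cong (_% 3) eq) ([m+kn]%n≡m%n 0 t 3))) λ ())
      where
      solve₁ : ∀ c → 1 + (2 + c * 3) * 2 + (3 + c * 3) ≡ 2 + (2 + c * 3) * 3
      solve₁ = solve-∀

module Binary where

  open Lucas 1 2-prime
  open Mod 2
  open Columns₂
  open ⇔-Reasoning

  C≡bin-double : ∀ s → (3 * s) C s ≡ bin s (s * 2)
  C≡bin-double s = trans (cong (_C s) (solve₁ s)) (C≡bin s (s * 2))
    where
    solve₁ : ∀ s → 3 * s ≡ s + s * 2
    solve₁ = solve-∀

  2∤S[2m,m]⇔ : ∀ m → 2 ∤ S (m * 2) m ⇔ 2 ∤ ((3 * m) C m)
  2∤S[2m,m]⇔ m = ⇔-trans (lem m) (mk⇔ (subst (2 ∤_) (sym (C≡bin-double m))) (subst (2 ∤_) (C≡bin-double m)))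
    where
    solve₁ : ∀ c → (1 + c * 2) * 2 ≡ (1 + c * 2) + (1 + c * 2)
    solve₁ = solve-∀
    solve₂ : ∀ c → (2 + c * 2) * 2 ≡ (2 + c * 2) + (2 + c * 2)
    solve₂ = solve-∀
    lem : ∀ m → 2 ∤ S (m * 2) m ⇔ 2 ∤ bin m (m * 2)
    lem m with m divMod 2
    ... | result zero zero refl = ⇔-refl
    ... | result (suc c) zero refl = begin
      2 ∤ S ((2 + c * 2) * 2) (2 + c * 2)      ≡⟨ cong (λ k → 2 ∤ S k (2 + c * 2)) (solve₂ c) ⟩
      2 ∤ col (2 + c * 2) (2 + c * 2)          ≈⟨ ∤-resp (col-even c (2 + c * 2)) ⟩
      2 ∤ bin c (2 + c * 2)                    ≈⟨ ∤-resp (bin-diagonal c) ⟨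
      2 ∤ bin (1 + c) (2 + c * 2)              ≡⟨ cong (2 ∤_) (*-identityʳ (bin (suc c) (2 + c * 2))) ⟨
      2 ∤ bin (1 + c) (2 + c * 2) * 1          ≈⟨ ∤-resp (lucas (1 + c) (2 + c * 2) 0 0 z<s z<s) ⟨
      2 ∤ bin (2 + c * 2) ((2 + c * 2) * 2)    ∎
    ... | result c (suc zero) refl = begin
      2 ∤ S ((1 + c * 2) * 2) (1 + c * 2)      ≡⟨ cong (λ k → 2 ∤ S k (1 + c * 2)) (solve₁ c) ⟩
      2 ∤ col (1 + c * 2) (1 + c * 2)          ≈⟨ ∤-resp (col-odd c (1 + c * 2)) ⟩
      2 ∤ bin c (1 + c * 2)                    ≡⟨ cong (2 ∤_) (*-identityʳ _) ⟨
      2 ∤ bin c (1 + c * 2) * 1                ≈⟨ ∤-resp (lucas c (1 + c * 2) 1 0 ≤-refl z<s) ⟨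
      2 ∤ bin (1 + c * 2) ((1 + c * 2) * 2)    ∎

  2∤S[4c+1,2c+1]⇔ : ∀ c → 2 ∤ S (1 + c * 4) (1 + c * 2) ⇔ 2 ∤ ((3 * c) C c)
  2∤S[4c+1,2c+1]⇔ c = begin
    2 ∤ S (1 + c * 4) (1 + c * 2)            ≡⟨ cong (λ k → 2 ∤ S k (1 + c * 2)) (solve₁ c) ⟩
    2 ∤ col (1 + c * 2) (c * 2)              ≈⟨ ∤-resp (col-odd c (c * 2)) ⟩
    2 ∤ bin c (c * 2)                        ≡⟨ cong (2 ∤_) (C≡bin-double c) ⟨
    2 ∤ ((3 * c) C c)                        ∎
    where
    solve₁ : ∀ c → 1 + c * 4 ≡ c * 2 + (1 + c * 2)
    solve₁ = solve-∀

  2∤S[8s+3,4s+2]⇔ : ∀ s → 2 ∤ S (3 + s * 8) (2 + s * 4) ⇔ 2 ∤ ((3 * s) C s)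
  2∤S[8s+3,4s+2]⇔ s = begin
    2 ∤ S (3 + s * 8) (2 + s * 4)                  ≡⟨ cong₂ (λ k j → 2 ∤ S k j) (solve₁ s) (solve₂ s) ⟩
    2 ∤ col (2 + s * 2 * 2) (1 + s * 2 * 2)        ≈⟨ ∤-resp (col-even (s * 2) (1 + s * 2 * 2)) ⟩
    2 ∤ bin (s * 2) (1 + s * 2 * 2)                ≈⟨ ∤-resp (lucas s (s * 2) 0 1 z<s ≤-refl) ⟩
    2 ∤ bin s (s * 2) * 1                          ≡⟨ cong (2 ∤_) (trans (*-identityʳ _) (sym (C≡bin-double s))) ⟩
    2 ∤ ((3 * s) C s)                              ∎
    where
    solve₁ : ∀ s → 3 + s * 8 ≡ (1 + s * 2 * 2) + (2 + s * 2 * 2)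
    solve₁ = solve-∀
    solve₂ : ∀ s → 2 + s * 4 ≡ 2 + s * 2 * 2
    solve₂ = solve-∀

  -- Both arguments of the resulting `bin` are odd, so their last binary digits carry. This is what
  -- limits ε to 2 in part (i).
  2∣S[8s+7,4s+4] : ∀ s → 2 ∣ S (7 + s * 8) (4 + s * 4)
  2∣S[8s+7,4s+4] s = subst₂ (λ k j → 2 ∣ S k j) (solve₁ s) (solve₂ s)
    (∣-resp (≈-sym (≈-trans (col-even c (1 + c * 2)) (lucas s c 1 1 ≤-refl ≤-refl))) (∣n⇒∣m*n (bin s c) ∣-refl))
    where
    c = 1 + s * 2
    solve₁ : ∀ s → (1 + (1 + s * 2) * 2) + (2 + (1 + s * 2) * 2) ≡ 7 + s * 8
    solve₁ = solve-∀
    solve₂ : ∀ s → 2 + (1 + s * 2) * 2 ≡ 4 + s * 4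
    solve₂ = solve-∀

-- Iterated differences

Seq : Set
Seq = ℕ → ℤ

infixr 9 _↑_

_↑_ : (Seq → Seq) → ℕ → Seq → Seq
(F ↑ zero)  f = f
(F ↑ suc n) f = (F ↑ n) (F f)

↑-+ : ∀ F a b f → (F ↑ (a + b)) f ≡ (F ↑ b) ((F ↑ a) f)
↑-+ F zero    b f = refl
↑-+ F (suc a) b f = ↑-+ F a b (F f)

-- Sequences are compared pointwise, so an operator must carry its congruence for pointwise equality
-- along with its linearity.
record Linear (F : Seq → Seq) : Set where
  field
    cong-≗ : ∀ {f g} → f ≗ g → F f ≗ F g
    comb   : ∀ f c g → F (λ y → f y +ᶻ c *ᶻ g y) ≗ λ y → F f y +ᶻ c *ᶻ F g y

open Linear

↑-linear : ∀ {F} → Linear F → ∀ n → Linear (F ↑ n)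
↑-linear lin zero    = record { cong-≗ = λ e → e ; comb = λ _ _ _ _ → refl }
↑-linear lin (suc n) = record
  { cong-≗ = λ e → cong-≗ ih (cong-≗ lin e)
  ; comb   = λ f c g y → trans (cong-≗ ih (comb lin f c g) y) (comb ih _ c _ y)
  }
  where ih = ↑-linear lin n

↑-comm : ∀ {F G : Seq → Seq} → Linear F → (∀ f → F (G f) ≗ G (F f)) → ∀ n f → (F ↑ n) (G f) ≗ G ((F ↑ n) f)
↑-comm lin comm zero    f y = refl
↑-comm lin comm (suc n) f y = trans (cong-≗ (↑-linear lin n) (comm f) y) (↑-comm lin comm n _ y)

D : Seq → Seq
D f y = f (suc y) -ᶻ f y

comb-minus : ∀ a b c x y → (a +ᶻ c *ᶻ x) -ᶻ (b +ᶻ c *ᶻ y) ≡ (a -ᶻ b) +ᶻ c *ᶻ (x -ᶻ y)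
comb-minus = solve-∀ᶻ

D-linear : Linear D
D-linear = record
  { cong-≗ = λ e y → cong₂ _-ᶻ_ (e (suc y)) (e y)
  ; comb   = λ f c g y → comb-minus (f (suc y)) (f y) c (g (suc y)) (g y)
  }

D↑-linear : ∀ n → Linear (D ↑ n)
D↑-linear = ↑-linear D-linear

-- The Leibniz rule for a factor y: D^n(y f) = y D^n f + n E D^(n-1) f, where E = D + 1 is the
-- shift.
D↑-id* : ∀ a f y → (D ↑ suc a) (λ z → + z *ᶻ f z) y
       ≡ + y *ᶻ (D ↑ suc a) f y +ᶻ + suc a *ᶻ ((D ↑ suc a) f y +ᶻ (D ↑ a) f y)
D↑-id* zero    f y = trans (cong (λ n → n *ᶻ f (suc y) -ᶻ + y *ᶻ f y) (ℤ.pos-+ 1 y)) (solve₁ (+ y) (f (suc y)) (f y))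
  where
  solve₁ : ∀ y u v → (1ℤ +ᶻ y) *ᶻ u -ᶻ y *ᶻ v ≡ y *ᶻ (u -ᶻ v) +ᶻ 1ℤ *ᶻ ((u -ᶻ v) +ᶻ v)
  solve₁ = solve-∀ᶻ
D↑-id* (suc a) f y = begin
  (D ↑ suc a) (D (λ z → + z *ᶻ f z)) y
    ≡⟨ cong-≗ (D↑-linear (suc a)) (λ z → trans (D↑-id* 0 f z) (solve₁ (+ z) (D f z) (f z))) y ⟩
  (D ↑ suc a) (λ z → + z *ᶻ D f z +ᶻ 1ℤ *ᶻ (D f z +ᶻ 1ℤ *ᶻ f z)) y
    ≡⟨ comb (D↑-linear (suc a)) (λ z → + z *ᶻ D f z) 1ℤ _ y ⟩
  (D ↑ suc a) (λ z → + z *ᶻ D f z) y +ᶻ 1ℤ *ᶻ (D ↑ suc a) (λ z → D f z +ᶻ 1ℤ *ᶻ f z) y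
    ≡⟨ cong₂ (λ u v → u +ᶻ 1ℤ *ᶻ v) (D↑-id* a (D f) y) (comb (D↑-linear (suc a)) (D f) 1ℤ f y) ⟩
  (+ y *ᶻ (D ↑ suc a) (D f) y +ᶻ + suc a *ᶻ ((D ↑ suc a) (D f) y +ᶻ (D ↑ suc a) f y))
    +ᶻ 1ℤ *ᶻ ((D ↑ suc a) (D f) y +ᶻ 1ℤ *ᶻ (D ↑ suc a) f y)
    ≡⟨ solve₂ (+ y) ((D ↑ suc a) (D f) y) ((D ↑ suc a) f y) (+ suc a) ⟩
  + y *ᶻ (D ↑ suc a) (D f) y +ᶻ (1ℤ +ᶻ + suc a) *ᶻ ((D ↑ suc a) (D f) y +ᶻ (D ↑ suc a) f y)
    ∎
  where
  open ≡-Reasoning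
  solve₁ : ∀ y u v → y *ᶻ u +ᶻ 1ℤ *ᶻ (u +ᶻ v) ≡ y *ᶻ u +ᶻ 1ℤ *ᶻ (u +ᶻ 1ℤ *ᶻ v)
  solve₁ = solve-∀ᶻ
  solve₂ : ∀ y u v n → (y *ᶻ u +ᶻ n *ᶻ (u +ᶻ v)) +ᶻ 1ℤ *ᶻ (u +ᶻ 1ℤ *ᶻ v) ≡ y *ᶻ u +ᶻ (1ℤ +ᶻ n) *ᶻ (u +ᶻ v)
  solve₂ = solve-∀ᶻ

-- Differences of powers

pow : ℕ → Seq
pow q y = + (y ^ q)

pow-suc : ∀ q → pow (suc q) ≗ λ y → + y *ᶻ pow q y
pow-suc q y = ℤ.pos-* y (y ^ q)

D↑-zero : ∀ n y → (D ↑ n) (λ _ → 0ℤ) y ≡ 0ℤ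
D↑-zero zero    y = refl
D↑-zero (suc n) y = D↑-zero n y

D↑-pow-suc : ∀ a q y → (D ↑ suc a) (pow (suc q)) y
           ≡ + y *ᶻ (D ↑ suc a) (pow q) y +ᶻ + suc a *ᶻ ((D ↑ suc a) (pow q) y +ᶻ (D ↑ a) (pow q) y)
D↑-pow-suc a q y = trans (cong-≗ (D↑-linear (suc a)) (pow-suc q) y) (D↑-id* a (pow q) y)

-- At 0 the Leibniz rule loses its first term, and what is left is the recurrence of `S` multiplied
-- by `suc a !`.
D↑-pow-0 : ∀ a q → (D ↑ a) (pow q) 0 ≡ + (a ! * S q a)
D↑-pow-0 zero    zero    = refl
D↑-pow-0 zero    (suc q) = refl
D↑-pow-0 (suc a) zero    = trans (D↑-zero a 0) (cong +_ (sym (*-zeroʳ (suc a !))))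
D↑-pow-0 (suc a) (suc q) = begin
  (D ↑ suc a) (pow (suc q)) 0
    ≡⟨ D↑-pow-suc a q 0 ⟩
  0ℤ *ᶻ (D ↑ suc a) (pow q) 0 +ᶻ + suc a *ᶻ ((D ↑ suc a) (pow q) 0 +ᶻ (D ↑ a) (pow q) 0)
    ≡⟨ ℤ.+-identityˡ _ ⟩
  + suc a *ᶻ ((D ↑ suc a) (pow q) 0 +ᶻ (D ↑ a) (pow q) 0)
    ≡⟨ cong (+ suc a *ᶻ_) (cong₂ _+ᶻ_ (D↑-pow-0 (suc a) q) (D↑-pow-0 a q)) ⟩
  + suc a *ᶻ + (suc a ! * S q (suc a) + a ! * S q a)
    ≡⟨ ℤ.pos-* (suc a) _ ⟨
  + (suc a * (suc a ! * S q (suc a) + a ! * S q a))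
    ≡⟨ cong +_ (solve₁ (suc a) (a !) (S q (suc a)) (S q a)) ⟩
  + (suc a ! * S (suc q) (suc a))
    ∎
  where
  open ≡-Reasoning
  solve₁ : ∀ n f x y → n * (n * f * x + f * y) ≡ n * f * (n * x + y)
  solve₁ = solve-∀

!∣D↑-pow : ∀ a q y → + (a !) ∣ᶻ (D ↑ a) (pow q) y
!∣D↑-pow zero    q       y = dividesᶻ (pow q y) (sym (ℤ.*-identityʳ (pow q y)))
!∣D↑-pow (suc a) zero    y = dividesᶻ 0ℤ (D↑-zero a y)
!∣D↑-pow (suc a) (suc q) y = subst (+ (suc a !) ∣ᶻ_) (sym (trans (D↑-pow-suc a q y) (solve₁ (+ y) (+ suc a) _ _)))
  (ℤ∣.∣m∣n⇒∣m+n
    (ℤ∣.∣n⇒∣m*n (+ y +ᶻ + suc a) (!∣D↑-pow (suc a) q y))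
    (subst (_∣ᶻ + suc a *ᶻ (D ↑ a) (pow q) y) (sym (ℤ.pos-* (suc a) (a !)))
      (ℤ∣.*-monoʳ-∣ (+ suc a) (!∣D↑-pow a q y))))
  where
  solve₁ : ∀ y n u v → y *ᶻ u +ᶻ n *ᶻ (u +ᶻ v) ≡ (y +ᶻ n) *ᶻ u +ᶻ n *ᶻ v
  solve₁ = solve-∀ᶻ

-- Only the term at 0 of the alternating sum survives. This will dispose of the remainder r of N
-- modulo p.
D↑-supported-at-0 : ∀ r f → (∀ i → i < r → f (suc i) ≡ 0ℤ) → (D ↑ r) f 0 ≡ (-ᶻ 1ℤ) ^ᶻ r *ᶻ f 0
D↑-supported-at-0 zero    f f≡0 = sym (ℤ.*-identityˡ (f 0))
D↑-supported-at-0 (suc r) f f≡0 = begin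
  (D ↑ r) (D f) 0
    ≡⟨ D↑-supported-at-0 r (D f) (λ i i<r → cong₂ _-ᶻ_ (f≡0 (suc i) (s<s i<r)) (f≡0 i (m<n⇒m<1+n i<r))) ⟩
  (-ᶻ 1ℤ) ^ᶻ r *ᶻ (f 1 -ᶻ f 0)
    ≡⟨ cong (λ x → (-ᶻ 1ℤ) ^ᶻ r *ᶻ (x -ᶻ f 0)) (f≡0 0 z<s) ⟩
  (-ᶻ 1ℤ) ^ᶻ r *ᶻ (0ℤ -ᶻ f 0)
    ≡⟨ solve₁ ((-ᶻ 1ℤ) ^ᶻ r) (f 0) ⟩
  (-ᶻ 1ℤ) ^ᶻ suc r *ᶻ f 0
    ∎
  where
  open ≡-Reasoning
  solve₁ : ∀ σ x → σ *ᶻ (0ℤ -ᶻ x) ≡ (-ᶻ 1ℤ *ᶻ σ) *ᶻ x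
  solve₁ = solve-∀ᶻ

-- The sum over the antidiagonal a + b = n; shifting the second argument avoids subtraction in the
-- index.
Σ△ : ℕ → (ℕ → ℕ → ℤ) → ℤ
Σ△ zero    f = f 0 0
Σ△ (suc n) f = f (suc n) 0 +ᶻ Σ△ n (λ a b → f a (suc b))

Σ△-cong : ∀ n f g → (∀ a b → f a b ≡ g a b) → Σ△ n f ≡ Σ△ n g
Σ△-cong zero    f g e = e 0 0
Σ△-cong (suc n) f g e = cong₂ _+ᶻ_ (e (suc n) 0) (Σ△-cong n _ _ λ a b → e a (suc b))

Σ△-+ : ∀ n f g → Σ△ n (λ a b → f a b +ᶻ g a b) ≡ Σ△ n f +ᶻ Σ△ n g
Σ△-+ zero    f g = refl
Σ△-+ (suc n) f g = trans (cong (f (suc n) 0 +ᶻ g (suc n) 0 +ᶻ_) (Σ△-+ n (λ a b → f a (suc b)) (λ a b → g a (suc b)))) (solve₁ (f (suc n) 0) (g (suc n) 0) _ _)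
  where
  solve₁ : ∀ a b x y → (a +ᶻ b) +ᶻ (x +ᶻ y) ≡ (a +ᶻ x) +ᶻ (b +ᶻ y)
  solve₁ = solve-∀ᶻ

Σ△-sucˡ : ∀ n f → Σ△ (suc n) f ≡ Σ△ n (λ a b → f (suc a) b) +ᶻ f 0 (suc n)
Σ△-sucˡ zero    f = refl
Σ△-sucˡ (suc n) f = trans (cong (f (suc (suc n)) 0 +ᶻ_) (Σ△-sucˡ n (λ a b → f a (suc b)))) (sym (ℤ.+-assoc (f (suc (suc n)) 0) _ _))

Σ△-pascal : ∀ m (F : ℕ → ℕ → ℤ) → Σ△ (suc m) (λ a b → + bin a b *ᶻ F a b)
          ≡ Σ△ m (λ a b → + bin a b *ᶻ (F (suc a) b +ᶻ F a (suc b)))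
Σ△-pascal m F = begin
  Σ△ (suc m) G
    ≡⟨ cong₂ _+ᶻ_ (split (suc m) 0 (λ ()))
         (Σ△-cong m (λ a b → G a (suc b)) (λ a b → P a (suc b) +ᶻ Q a (suc b)) λ a b → split a (suc b) (λ _ ())) ⟩
  Σ△ (suc m) (λ a b → P a b +ᶻ Q a b)
    ≡⟨ Σ△-+ (suc m) P Q ⟩
  Σ△ (suc m) P +ᶻ Σ△ (suc m) Q
    ≡⟨ cong₂ _+ᶻ_ (trans (Σ△-sucˡ m P) (ℤ.+-identityʳ (Σ△ m λ a b → P (suc a) b)))
         (ℤ.+-identityˡ (Σ△ m λ a b → Q a (suc b))) ⟩
  Σ△ m (λ a b → P (suc a) b) +ᶻ Σ△ m (λ a b → Q a (suc b))
    ≡⟨ Σ△-+ m (λ a b → P (suc a) b) (λ a b → Q a (suc b)) ⟨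
  Σ△ m (λ a b → P (suc a) b +ᶻ Q a (suc b))
    ≡⟨ Σ△-cong m (λ a b → P (suc a) b +ᶻ Q a (suc b)) H
         (λ a b → sym (ℤ.*-distribˡ-+ (+ bin a b) (F (suc a) b) (F a (suc b)))) ⟩
  Σ△ m H
    ∎
  where
  open ≡-Reasoning
  G H P Q : ℕ → ℕ → ℤ
  G a b = + bin a b *ᶻ F a b
  H a b = + bin a b *ᶻ (F (suc a) b +ᶻ F a (suc b))
  P zero    b       = 0ℤ
  P (suc a) b       = + bin a b *ᶻ F (suc a) b
  Q a       zero    = 0ℤ
  Q a       (suc b) = + bin a b *ᶻ F a (suc b)
  -- Pascal's recursion fails only at (0, 0), which is on no antidiagonal a + b = suc m. On the
  -- border it holds because `P` and `Q` are 0 where a neighbour is missing.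
  split : ∀ a b → (a ≡ 0 → b ≢ 0) → G a b ≡ P a b +ᶻ Q a b
  split zero    zero    h = contradiction refl (h refl)
  split zero    (suc b) h = sym (ℤ.+-identityˡ (1ℤ *ᶻ F 0 (suc b)))
  split (suc a) zero    h =
    trans (cong (λ x → + x *ᶻ F (suc a) 0) (sym (bin-zeroʳ a))) (sym (ℤ.+-identityʳ (+ bin a 0 *ᶻ F (suc a) 0)))
  split (suc a) (suc b) h = trans (cong (_*ᶻ F (suc a) (suc b)) (ℤ.pos-+ (bin a (suc b)) (bin (suc a) b)))
    (ℤ.*-distribʳ-+ (F (suc a) (suc b)) (+ bin a (suc b)) (+ bin (suc a) b))

Σ△-mod : ∀ m {P} F → (∀ a b → a + suc b ≡ m → P ∣ᶻ F a (suc b)) → P ∣ᶻ Σ△ m F -ᶻ F m 0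
Σ△-mod zero    F h = dividesᶻ 0ℤ (ℤ.+-inverseʳ (F 0 0))
Σ△-mod (suc m) {P} F h = subst (P ∣ᶻ_) (solve₁ (F (suc m) 0) _) (∣Σ△ m (λ a b → F a (suc b)) λ a b e → h a b (trans (+-suc a b) (cong suc e)))
  where
  solve₁ : ∀ x y → y ≡ (x +ᶻ y) -ᶻ x
  solve₁ = solve-∀ᶻ
  ∣Σ△ : ∀ n G → (∀ a b → a + b ≡ n → P ∣ᶻ G a b) → P ∣ᶻ Σ△ n G
  ∣Σ△ zero    G h = h 0 0 refl
  ∣Σ△ (suc n) G h = ℤ∣.∣m∣n⇒∣m+n (h (suc n) 0 (+-identityʳ _))
    (∣Σ△ n (λ a b → G a (suc b)) λ a b e → h a (suc b) (trans (+-suc a b) (cong suc e)))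

-- Valuations

∣-^ : ∀ p {m n} → m ≤ n → p ^ m ∣ p ^ n
∣-^ p {m} {n} m≤n = subst (p ^ m ∣_)
  (trans (sym (^-distribˡ-+-* p m (n ∸ m))) (cong (p ^_) (m+[n∸m]≡n m≤n))) (m∣m*n (p ^ (n ∸ m)))

ν-exact : ∀ p s d t .{{_ : NonTrivial p}} .{{_ : NonZero s}} →
          p ^ d ∣ s → p ^ suc d ∣ s ⇔ p ∣ t → ν p s ≥ d × (ν p s ≡ d ⇔ p ∤ t)
ν-exact p s d t pᵈ∣s pᵈ⁺¹∣s⇔p∣t = d≤ν , mk⇔
  (λ { refl p∣t → ν-∤ p s (from pᵈ⁺¹∣s⇔p∣t p∣t) })
  (λ p∤t → ≤-antisym (≮⇒≥ λ d<ν → p∤t (to pᵈ⁺¹∣s⇔p∣t (∣-trans (∣-^ p d<ν) (ν-∣ p s)))) d≤ν)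
  where
  d≤ν : d ≤ ν p s
  d≤ν = ≮⇒≥ λ ν<d → ν-∤ p s (∣-trans (∣-^ p ν<d) pᵈ∣s)

module Prime-powers {p : ℕ} (p-prime : Prime p) where

  private instance
    p-nonZero : NonZero p
    p-nonZero = prime⇒nonZero p-prime

  ∤-* : ∀ {x y} → p ∤ x → p ∤ y → p ∤ x * y
  ∤-* {x} {y} p∤x p∤y d = [ p∤x , p∤y ] (euclidsLemma x y p-prime d)

  p∤1 : p ∤ 1
  p∤1 d = <⇒≱ (nonTrivial⇒n>1 p {{prime⇒nonTrivial p-prime}}) (∣⇒≤ d)

  ∣-cancel : ∀ {w x} → p ∤ w → p ∣ w * x → p ∣ x
  ∣-cancel {w} {x} p∤w d = [ (λ p∣w → contradiction p∣w p∤w) , (λ p∣x → p∣x) ] (euclidsLemma w x p-prime d)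

  ^∣-cancel : ∀ n {w x} → p ∤ w → p ^ n ∣ w * x → p ^ n ∣ x
  ^∣-cancel zero            p∤w d = 1∣ _
  ^∣-cancel (suc n) {w} {x} p∤w d with ∣-cancel p∤w (∣-trans (m∣m*n (p ^ n)) d)
  ... | divides y refl = subst (p ^ suc n ∣_) (*-comm p y) (*-monoʳ-∣ p
    (^∣-cancel n p∤w (*-cancelˡ-∣ p (subst (p * p ^ n ∣_) (solve₁ w y p) d))))
    where
    solve₁ : ∀ w y p → w * (y * p) ≡ p * (w * y)
    solve₁ = solve-∀

  -- The multiples of p among 1, ..., r + mp contribute p^m · m!, and `u` is the product of the
  -- other factors.
  !-divMod : ∀ m r → r < p → ∃ λ u → p ∤ u × (r + m * p) ! ≡ p ^ m * m ! * u
  !-divMod zero    zero    _   = 1 , p∤1 , refl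
  !-divMod (suc m) zero    _   = u , p∤u , (begin
    (p + m * p) !                           ≡⟨ cong (λ k → (k + m * p) !) (suc-pred p) ⟨
    suc (pred p + m * p) * (pred p + m * p) !
      ≡⟨ cong₂ _*_ (cong (_+ m * p) (suc-pred p)) eq ⟩
    suc m * p * (p ^ m * m ! * u)           ≡⟨ solve₁ (suc m) p (p ^ m) (m !) u ⟩
    p ^ suc m * suc m ! * u                 ∎)
    where
    open ≡-Reasoning
    ih = !-divMod m (pred p) (≤-reflexive (suc-pred p))
    u = proj₁ ih
    p∤u = proj₁ (proj₂ ih)
    eq = proj₂ (proj₂ ih)
    solve₁ : ∀ n p q f u → n * p * (q * f * u) ≡ p * q * (n * f) * u
    solve₁ = solve-∀
  !-divMod m       (suc r) r<p = suc (r + m * p) * u ,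
    ∤-* (λ d → 0<i<p⇒p∤i z<s r<p (∣m+n∣m⇒∣n (subst (p ∣_) (+-comm (suc r) (m * p)) d) (n∣m*n m))) p∤u ,
    trans (cong (suc (r + m * p) *_) eq) (solve₁ (suc (r + m * p)) (p ^ m) (m !) u)
    where
    ih = !-divMod m r (<⇒≤ r<p)
    u = proj₁ ih
    p∤u = proj₁ (proj₂ ih)
    eq = proj₂ (proj₂ ih)
    solve₁ : ∀ n q f u → n * (q * f * u) ≡ q * f * (n * u)
    solve₁ = solve-∀

  -- The strict bound `exponent<` is the point: it leaves a spare factor p in p^b / b! for b > 0.
  record !-Factorization (n : ℕ) : Set where
    constructor mk!
    field
      exponent unit : ℕ
      p∤unit        : p ∤ unit
      n!≡           : n ! ≡ p ^ exponent * unit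
      exponent<     : 0 < n → exponent < n

  !-factorization : ∀ n → !-Factorization n
  !-factorization = <-rec !-Factorization step
    where
    step : ∀ n → (∀ {m} → m < n → !-Factorization m) → !-Factorization n
    step n rec with n divMod p
    ... | result zero r refl = mk! 0 u p∤u eq (λ 0<n → 0<n)
      where
      fac = !-divMod 0 (toℕ r) (toℕ<n r)
      u = proj₁ fac
      p∤u = proj₁ (proj₂ fac)
      eq = proj₂ (proj₂ fac)
    ... | result (suc m) r refl = mk! (suc m + e) (v * u) (∤-* p∤v p∤u) (begin
        (toℕ r + suc m * p) !                ≡⟨ eq ⟩
        p ^ suc m * suc m ! * u              ≡⟨ cong (λ x → p ^ suc m * x * u) m!≡ ⟩
        p ^ suc m * (p ^ e * v) * u          ≡⟨ solve₁ (p ^ suc m) (p ^ e) v u ⟩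
        p ^ suc m * p ^ e * (v * u)          ≡⟨ cong (_* (v * u)) (^-distribˡ-+-* p (suc m) e) ⟨
        p ^ (suc m + e) * (v * u)            ∎)
        -- By induction e < suc m, so the exponent is less than twice suc m, which is at most n
        -- because p ≥ 2.
        (λ _ → <-≤-trans (+-monoʳ-< (suc m) (e< z<s)) 2m≤n)
      where
      open ≡-Reasoning
      fac = !-divMod (suc m) (toℕ r) (toℕ<n r)
      u = proj₁ fac
      p∤u = proj₁ (proj₂ fac)
      eq = proj₂ (proj₂ fac)
      2m≤n : suc m + suc m ≤ toℕ r + suc m * p
      2m≤n = ≤-trans (≤-reflexive (solve₂ (suc m)))
        (≤-trans (*-monoʳ-≤ (suc m) (nonTrivial⇒n>1 p {{prime⇒nonTrivial p-prime}})) (m≤n+m _ (toℕ r)))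
        where
        solve₂ : ∀ m → m + m ≡ m * 2
        solve₂ = solve-∀
      open !-Factorization (rec {suc m} (<-≤-trans (m<m+n (suc m) z<s) 2m≤n))
        renaming (exponent to e; unit to v; p∤unit to p∤v; n!≡ to m!≡; exponent< to e<)
      solve₁ : ∀ q q′ v u → q * (q′ * v) * u ≡ q * q′ * (v * u)
      solve₁ = solve-∀

-- Sequences supported on the multiples of p

lift : ℕ → Seq → Seq
lift p f y with p ∣? y
... | yes (divides j _) = f j
... | no  _             = 0ℤ

lift-* : ∀ p .{{_ : NonZero p}} f j → lift p f (j * p) ≡ f j
lift-* p f j with p ∣? j * p
... | yes (divides i eq) = cong f (*-cancelʳ-≡ i j p (sym eq))
... | no  p∤jp           = contradiction (n∣m*n j) p∤jp

lift-∤ : ∀ p f y → p ∤ y → lift p f y ≡ 0ℤ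
lift-∤ p f y p∤y with p ∣? y
... | yes p∣y = contradiction p∣y p∤y
... | no  _   = refl

∣-lift : ∀ p {k} f → (∀ j → k ∣ᶻ f j) → ∀ y → k ∣ᶻ lift p f y
∣-lift p f h y with p ∣? y
... | yes (divides j _) = h j
... | no  _             = dividesᶻ 0ℤ refl

Δ : ℕ → Seq → Seq
Δ p f y = f (p + y) -ᶻ f y

Δ-linear : ∀ p → Linear (Δ p)
Δ-linear p = record
  { cong-≗ = λ e y → cong₂ _-ᶻ_ (e (p + y)) (e y)
  ; comb   = λ f c g y → comb-minus (f (p + y)) (f y) c (g (p + y)) (g y)
  }

-- On the multiples of p, step p becomes step 1. Hence Δ^a h inherits from D^a(j^q) its divisibility
-- by a! and, at 0, its value a! S(q, a).
Δ-lift : ∀ p .{{_ : NonZero p}} f → Δ p (lift p f) ≗ lift p (D f)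
Δ-lift p f y = go (p ∣? y)
  where
  go : Dec (p ∣ y) → Δ p (lift p f) y ≡ lift p (D f) y
  go (yes (divides j refl)) = trans (cong₂ _-ᶻ_ (lift-* p f (suc j)) (lift-* p f j)) (sym (lift-* p (D f) j))
  go (no p∤y) = trans
    (cong₂ _-ᶻ_ (lift-∤ p f (p + y) (λ d → p∤y (∣m+n∣m⇒∣n d ∣-refl))) (lift-∤ p f y p∤y))
    (sym (lift-∤ p (D f) y p∤y))

Δ↑-lift : ∀ p .{{_ : NonZero p}} n f → (Δ p ↑ n) (lift p f) ≗ lift p ((D ↑ n) f)
Δ↑-lift p zero    f y = refl
Δ↑-lift p (suc n) f y = trans (cong-≗ (↑-linear (Δ-linear p) n) (Δ-lift p f) y) (Δ↑-lift p n (D f) y)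

D↑-lift-0 : ∀ p .{{_ : NonZero p}} r f → r < p → (D ↑ r) (lift p f) 0 ≡ (-ᶻ 1ℤ) ^ᶻ r *ᶻ f 0
D↑-lift-0 p r f r<p = trans
  (D↑-supported-at-0 r (lift p f) λ i i<r → lift-∤ p f (suc i) (0<i<p⇒p∤i z<s (≤-<-trans i<r r<p)))
  (cong ((-ᶻ 1ℤ) ^ᶻ r *ᶻ_) (lift-* p f 0))

-- Each term of (aⁿ - 1)/(a - 1) = 1 + a + ⋯ + aⁿ⁻¹ is 1 modulo a - 1.
geometric : ∀ a n → ∃ λ s → + (a ^ n) -ᶻ 1ℤ ≡ (+ a -ᶻ 1ℤ) *ᶻ (+ n +ᶻ (+ a -ᶻ 1ℤ) *ᶻ s)
geometric a zero    = 0ℤ , solve₁ (+ a)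
  where
  solve₁ : ∀ a → 0ℤ ≡ (a -ᶻ 1ℤ) *ᶻ (0ℤ +ᶻ (a -ᶻ 1ℤ) *ᶻ 0ℤ)
  solve₁ = solve-∀ᶻ
geometric a (suc n) with geometric a n
... | s , eq = + n +ᶻ + a *ᶻ s , (begin
  + (a * a ^ n) -ᶻ 1ℤ
    ≡⟨ cong (_-ᶻ 1ℤ) (ℤ.pos-* a (a ^ n)) ⟩
  + a *ᶻ + (a ^ n) -ᶻ 1ℤ
    ≡⟨ solve₁ (+ a) (+ (a ^ n)) ⟩
  + a *ᶻ (+ (a ^ n) -ᶻ 1ℤ) +ᶻ (+ a -ᶻ 1ℤ)
    ≡⟨ cong (λ x → + a *ᶻ x +ᶻ (+ a -ᶻ 1ℤ)) eq ⟩
  + a *ᶻ ((+ a -ᶻ 1ℤ) *ᶻ (+ n +ᶻ (+ a -ᶻ 1ℤ) *ᶻ s)) +ᶻ (+ a -ᶻ 1ℤ)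
    ≡⟨ solve₂ (+ a) (+ n) s ⟩
  (+ a -ᶻ 1ℤ) *ᶻ ((1ℤ +ᶻ + n) +ᶻ (+ a -ᶻ 1ℤ) *ᶻ (+ n +ᶻ + a *ᶻ s))
    ∎)
  where
  open ≡-Reasoning
  solve₁ : ∀ a x → a *ᶻ x -ᶻ 1ℤ ≡ a *ᶻ (x -ᶻ 1ℤ) +ᶻ (a -ᶻ 1ℤ)
  solve₁ = solve-∀ᶻ
  solve₂ : ∀ a n s → a *ᶻ ((a -ᶻ 1ℤ) *ᶻ (n +ᶻ (a -ᶻ 1ℤ) *ᶻ s)) +ᶻ (a -ᶻ 1ℤ)
         ≡ (a -ᶻ 1ℤ) *ᶻ ((1ℤ +ᶻ n) +ᶻ (a -ᶻ 1ℤ) *ᶻ (n +ᶻ a *ᶻ s))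
  solve₂ = solve-∀ᶻ

*-mono-∣ᶻ : ∀ {a b c d} → a ∣ᶻ b → c ∣ᶻ d → a *ᶻ c ∣ᶻ b *ᶻ d
*-mono-∣ᶻ {a} {b} {c} {d} p q = ℤ∣.∣-trans (ℤ∣.*-monoʳ-∣ a q) (ℤ∣.*-monoˡ-∣ d p)

-- For b = a^(p^L), `geometric` gives b^p - 1 = (b - 1)(p + (b - 1)s), and the second factor
-- supplies one more p.
lifting-exponent : ∀ p a L → + p ∣ᶻ + a -ᶻ 1ℤ → + (p ^ suc L) ∣ᶻ + (a ^ (p ^ L)) -ᶻ 1ℤ
lifting-exponent p a zero    d =
  subst₂ (λ x y → + x ∣ᶻ + y -ᶻ 1ℤ) (sym (*-identityʳ p)) (sym (*-identityʳ a)) d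
lifting-exponent p a (suc L) d with geometric (a ^ (p ^ L)) p
... | s , eq = subst₂ _∣ᶻ_ (sym (trans (cong +_ (*-comm p (p ^ suc L))) (ℤ.pos-* (p ^ suc L) p)))
  (sym (trans (cong (λ x → + x -ᶻ 1ℤ) (trans (cong (a ^_) (*-comm p (p ^ L))) (sym (^-*-assoc a (p ^ L) p)))) eq))
  (*-mono-∣ᶻ ih (ℤ∣.∣m∣n⇒∣m+n ℤ∣.∣-refl (ℤ∣.∣m⇒∣m*n s (ℤ∣.∣-trans p∣ ih))))
  where
  ih = lifting-exponent p a L d
  p∣ : + p ∣ᶻ + (p ^ suc L)
  p∣ = dividesᶻ (+ (p ^ L)) (trans (cong +_ (*-comm p (p ^ L))) (ℤ.pos-* (p ^ L) p))

n≤m^n : ∀ m n → 1 < m → n ≤ m ^ n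
n≤m^n m zero    _   = z≤n
n≤m^n m (suc n) 1<m = ≤-<-trans (n≤m^n m n 1<m) (^-monoʳ-< m 1<m (n<1+n n))

^-distrib-* : ∀ a b n → (a * b) ^ n ≡ a ^ n * b ^ n
^-distrib-* a b zero    = refl
^-distrib-* a b (suc n) = trans (cong (a * b *_) (^-distrib-* a b n)) (solve₁ a b (a ^ n) (b ^ n))
  where
  solve₁ : ∀ a b x y → a * b * (x * y) ≡ a * x * (b * y)
  solve₁ = solve-∀

∣-difference : ∀ {k a} b → k ∣ᶻ a -ᶻ b → ∃ λ x → a ≡ b +ᶻ k *ᶻ x
∣-difference {k} {a} b (dividesᶻ x eq) = x , trans (solve₁ a b) (cong (b +ᶻ_) (trans eq (ℤ.*-comm x k)))
  where
  solve₁ : ∀ a b → a ≡ b +ᶻ (a -ᶻ b)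
  solve₁ = solve-∀ᶻ

sign-square : ∀ r → (-ᶻ 1ℤ) ^ᶻ r *ᶻ (-ᶻ 1ℤ) ^ᶻ r ≡ 1ℤ
sign-square zero    = refl
sign-square (suc r) = trans (solve₁ ((-ᶻ 1ℤ) ^ᶻ r)) (sign-square r)
  where
  solve₁ : ∀ σ → (-ᶻ 1ℤ *ᶻ σ) *ᶻ (-ᶻ 1ℤ *ᶻ σ) ≡ σ *ᶻ σ
  solve₁ = solve-∀ᶻ

^∣-^ : ∀ p b → + (p ^ b) ∣ᶻ (-ᶻ + p) ^ᶻ b
^∣-^ p zero    = ℤ∣.∣-refl
^∣-^ p (suc b) = subst (_∣ᶻ (-ᶻ + p) ^ᶻ suc b) (sym (ℤ.pos-* p (p ^ b)))
  (*-mono-∣ᶻ (ℤ∣.∣m⇒∣-m {+ p} ℤ∣.∣-refl) (^∣-^ p b))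

-- The Z of the overview, as E^c D with E the shift by 1: c = 0 for p = 2 and c = 1 for p = 3. For p
-- = 5 one already has D^5 = Δ - 5 E(E² - E + 1)D, which is no longer of this form.
D-after : ℕ → Seq → Seq
D-after c f y = D f (c + y)

D-after-linear : ∀ c → Linear (D-after c)
D-after-linear c = record
  { cong-≗ = λ e y → cong-≗ D-linear e (c + y)
  ; comb   = λ f k g y → comb D-linear f k g (c + y)
  }

Δ-D-after : ∀ p c f → Δ p (D-after c f) ≗ D-after c (Δ p f)
Δ-D-after p c f y = trans
  (cong₂ (λ i j → f i -ᶻ f j -ᶻ D f (c + y)) (solve₁ c p y) (solve₂ c p y))
  (solve₃ (f (p + suc (c + y))) (f (p + (c + y))) (f (suc (c + y))) (f (c + y)))
  where
  solve₁ : ∀ c p y → suc (c + (p + y)) ≡ p + suc (c + y)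
  solve₁ = solve-∀
  solve₂ : ∀ c p y → c + (p + y) ≡ p + (c + y)
  solve₂ = solve-∀
  solve₃ : ∀ a b u v → (a -ᶻ b) -ᶻ (u -ᶻ v) ≡ (a -ᶻ u) -ᶻ (b -ᶻ v)
  solve₃ = solve-∀ᶻ

∣-D-after↑ : ∀ c n {k} f → (∀ y → k ∣ᶻ f y) → ∀ y → k ∣ᶻ (D-after c ↑ n) f y
∣-D-after↑ c zero    f h = h
∣-D-after↑ c (suc n) f h = ∣-D-after↑ c n (D-after c f) λ y → ℤ∣.∣m∣n⇒∣m-n (h (suc (c + y))) (h (c + y))

-- The valuation of S(k, N) at p

module Valuation
  (p c : ℕ) (p-prime : Prime p)
  (D↑p : ∀ f → (D ↑ p) f ≗ λ y → Δ p f y +ᶻ -ᶻ + p *ᶻ D-after c f y)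
  (fermat : ∀ y → p ∤ y → + p ∣ᶻ + (y ^ pred p) -ᶻ 1ℤ)
  where

  open Prime-powers p-prime

  private
    instance
      p-nonZero : NonZero p
      p-nonZero = prime⇒nonZero p-prime
      p-nonTrivial : NonTrivial p
      p-nonTrivial = prime⇒nonTrivial p-prime

    pred≢0 : NonZero (pred p)
    pred≢0 = >-nonZero (≤-pred (subst (1 <_) (sym (suc-pred p)) (nonTrivial⇒n>1 p)))

    Z : Seq → Seq
    Z = D-after c

  -- The binomial theorem for (Δ - pZ)^m, available because Δ and Z commute.
  D↑-binomial : ∀ m f y → (D ↑ (m * p)) f y
              ≡ Σ△ m (λ a b → + bin a b *ᶻ ((-ᶻ + p) ^ᶻ b *ᶻ (Z ↑ b) ((Δ p ↑ a) f) y))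
  D↑-binomial zero    f y = solve₁ (f y)
    where
    solve₁ : ∀ x → x ≡ 1ℤ *ᶻ (1ℤ *ᶻ x)
    solve₁ = solve-∀ᶻ
  D↑-binomial (suc m) f y = begin
    (D ↑ (p + m * p)) f y
      ≡⟨ cong-app (↑-+ D p (m * p) f) y ⟩
    (D ↑ (m * p)) ((D ↑ p) f) y
      ≡⟨ cong-≗ (D↑-linear (m * p)) (D↑p f) y ⟩
    (D ↑ (m * p)) f′ y
      ≡⟨ D↑-binomial m f′ y ⟩
    Σ△ m (λ a b → + bin a b *ᶻ ((-ᶻ + p) ^ᶻ b *ᶻ (Z ↑ b) ((Δ p ↑ a) f′) y))
      ≡⟨ Σ△-cong m _ (λ a b → + bin a b *ᶻ (F (suc a) b +ᶻ F a (suc b))) (λ a b → cong (+ bin a b *ᶻ_) (term a b)) ⟩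
    Σ△ m (λ a b → + bin a b *ᶻ (F (suc a) b +ᶻ F a (suc b)))
      ≡⟨ Σ△-pascal m F ⟨
    Σ△ (suc m) (λ a b → + bin a b *ᶻ F a b)
      ∎
    where
    open ≡-Reasoning
    f′ : Seq
    f′ z = Δ p f z +ᶻ -ᶻ + p *ᶻ Z f z
    F : ℕ → ℕ → ℤ
    F a b = (-ᶻ + p) ^ᶻ b *ᶻ (Z ↑ b) ((Δ p ↑ a) f) y
    solve₁ : ∀ q n u v → q *ᶻ (u +ᶻ n *ᶻ v) ≡ q *ᶻ u +ᶻ (n *ᶻ q) *ᶻ v
    solve₁ = solve-∀ᶻ
    term : ∀ a b → (-ᶻ + p) ^ᶻ b *ᶻ (Z ↑ b) ((Δ p ↑ a) f′) y ≡ F (suc a) b +ᶻ F a (suc b)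
    term a b = begin
      (-ᶻ + p) ^ᶻ b *ᶻ (Z ↑ b) ((Δ p ↑ a) f′) y
        ≡⟨ cong ((-ᶻ + p) ^ᶻ b *ᶻ_) (cong-≗ (↑-linear (D-after-linear c) b) (λ z → trans
             (comb (↑-linear (Δ-linear p) a) (Δ p f) (-ᶻ + p) (Z f) z)
             (cong (λ x → (Δ p ↑ suc a) f z +ᶻ -ᶻ + p *ᶻ x) (↑-comm {G = Z} (Δ-linear p) (Δ-D-after p c) a f z))) y) ⟩
      (-ᶻ + p) ^ᶻ b *ᶻ (Z ↑ b) (λ z → (Δ p ↑ suc a) f z +ᶻ -ᶻ + p *ᶻ Z ((Δ p ↑ a) f) z) y
        ≡⟨ cong ((-ᶻ + p) ^ᶻ b *ᶻ_) (comb (↑-linear (D-after-linear c) b) ((Δ p ↑ suc a) f) (-ᶻ + p) (Z ((Δ p ↑ a) f)) y) ⟩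
      (-ᶻ + p) ^ᶻ b *ᶻ ((Z ↑ b) ((Δ p ↑ suc a) f) y +ᶻ -ᶻ + p *ᶻ (Z ↑ suc b) ((Δ p ↑ a) f) y)
        ≡⟨ solve₁ ((-ᶻ + p) ^ᶻ b) (-ᶻ + p) _ _ ⟩
      F (suc a) b +ᶻ F a (suc b)
        ∎

  -- ν_p (b!) < b for b > 0, hence p^b / b! is p-integral and divisible by p.
  ∣-binomial-term : ∀ a b e v → (a + suc b) ! ≡ p ^ e * v → p ^ suc e ∣ bin a (suc b) * (p ^ suc b * a !)
  ∣-binomial-term a b e v m!≡ = ^∣-cancel (suc e) p∤unit (divides (v * p ^ (b ∸ exponent)) (begin
    unit * (bin a (suc b) * (p * p ^ b * a !))
      ≡⟨ cong (λ x → unit * (bin a (suc b) * (p * x * a !))) p^b≡ ⟩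
    unit * (bin a (suc b) * (p * (p ^ exponent * p ^ (b ∸ exponent)) * a !))
      ≡⟨ solve₁ unit (bin a (suc b)) p (p ^ exponent) (p ^ (b ∸ exponent)) (a !) ⟩
    p * p ^ (b ∸ exponent) * (bin a (suc b) * (a ! * (p ^ exponent * unit)))
      ≡⟨ cong (λ x → p * p ^ (b ∸ exponent) * (bin a (suc b) * (a ! * x))) n!≡ ⟨
    p * p ^ (b ∸ exponent) * (bin a (suc b) * (a ! * suc b !))
      ≡⟨ cong (p * p ^ (b ∸ exponent) *_) (trans (bin-! a (suc b)) m!≡) ⟩
    p * p ^ (b ∸ exponent) * (p ^ e * v)
      ≡⟨ solve₂ p (p ^ (b ∸ exponent)) (p ^ e) v ⟩
    v * p ^ (b ∸ exponent) * p ^ suc e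
      ∎))
    where
    open ≡-Reasoning
    open !-Factorization (!-factorization (suc b))
    p^b≡ : p ^ b ≡ p ^ exponent * p ^ (b ∸ exponent)
    p^b≡ = trans (cong (p ^_) (sym (m+[n∸m]≡n (≤-pred (exponent< z<s))))) (^-distribˡ-+-* p exponent (b ∸ exponent))
    solve₁ : ∀ u x p q r f → u * (x * (p * (q * r) * f)) ≡ p * r * (x * (f * (q * u)))
    solve₁ = solve-∀
    solve₂ : ∀ p r q v → p * r * (q * v) ≡ v * r * (p * q)
    solve₂ = solve-∀

  -- The term of index (a, b) carries C(m, a) p^b from the expansion and a! from Δ^a f, together m!
  -- p^b / b!. For b > 0 this is divisible by p^(e + 1), so only b = 0 remains.
  D↑-mod : ∀ m e v f → m ! ≡ p ^ e * v → (∀ a y → + (a !) ∣ᶻ (Δ p ↑ a) f y) →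
           ∀ y → + (p ^ suc e) ∣ᶻ (D ↑ (m * p)) f y -ᶻ (Δ p ↑ m) f y
  D↑-mod m e v f m!≡ !∣ y = subst₂ (λ x z → + (p ^ suc e) ∣ᶻ x -ᶻ z) (sym (D↑-binomial m f y)) F-m-0 (Σ△-mod m F term)
    where
    F : ℕ → ℕ → ℤ
    F a b = + bin a b *ᶻ ((-ᶻ + p) ^ᶻ b *ᶻ (Z ↑ b) ((Δ p ↑ a) f) y)
    solve₁ : ∀ x → 1ℤ *ᶻ (1ℤ *ᶻ x) ≡ x
    solve₁ = solve-∀ᶻ
    F-m-0 : F m 0 ≡ (Δ p ↑ m) f y
    F-m-0 = trans (cong (λ x → + x *ᶻ (1ℤ *ᶻ (Δ p ↑ m) f y)) (bin-zeroʳ m)) (solve₁ _)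
    term : ∀ a b → a + suc b ≡ m → + (p ^ suc e) ∣ᶻ F a (suc b)
    term a b refl = ℤ∣.∣-trans (ℤ∣.∣ᵤ⇒∣ (∣-binomial-term a b e v m!≡))
      (subst (_∣ᶻ F a (suc b))
        (sym (trans (ℤ.pos-* (bin a (suc b)) _) (cong (+ bin a (suc b) *ᶻ_) (ℤ.pos-* (p ^ suc b) (a !)))))
        (ℤ∣.*-monoʳ-∣ (+ bin a (suc b))
          (*-mono-∣ᶻ (^∣-^ p (suc b)) (∣-D-after↑ c (suc b) ((Δ p ↑ a) f) (!∣ a) y))))

  D↑-lift-pow : ∀ q m r e v → r < p → m ! ≡ p ^ e * v → ∃ λ y →
                (D ↑ (r + m * p)) (lift p (pow q)) 0 ≡ (-ᶻ 1ℤ) ^ᶻ r *ᶻ + (m ! * S q m) +ᶻ + (p ^ suc e) *ᶻ y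
  D↑-lift-pow q m r e v r<p m!≡ = (D ↑ r) Y 0 , (begin
    (D ↑ (r + m * p)) h 0
      ≡⟨ cong (λ n → (D ↑ n) h 0) (+-comm r (m * p)) ⟩
    (D ↑ (m * p + r)) h 0
      ≡⟨ cong-app (↑-+ D (m * p) r h) 0 ⟩
    (D ↑ r) ((D ↑ (m * p)) h) 0
      ≡⟨ cong-≗ (D↑-linear r) (λ y → proj₂ (split y)) 0 ⟩
    (D ↑ r) (λ y → lift p ((D ↑ m) (pow q)) y +ᶻ + (p ^ suc e) *ᶻ Y y) 0
      ≡⟨ comb (D↑-linear r) _ (+ (p ^ suc e)) Y 0 ⟩
    (D ↑ r) (lift p ((D ↑ m) (pow q))) 0 +ᶻ + (p ^ suc e) *ᶻ (D ↑ r) Y 0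
      ≡⟨ cong (_+ᶻ + (p ^ suc e) *ᶻ (D ↑ r) Y 0) (trans (D↑-lift-0 p r _ r<p)
           (cong ((-ᶻ 1ℤ) ^ᶻ r *ᶻ_) (D↑-pow-0 m q))) ⟩
    (-ᶻ 1ℤ) ^ᶻ r *ᶻ + (m ! * S q m) +ᶻ + (p ^ suc e) *ᶻ (D ↑ r) Y 0
      ∎)
    where
    open ≡-Reasoning
    h = lift p (pow q)
    !∣Δ↑h : ∀ a y → + (a !) ∣ᶻ (Δ p ↑ a) h y
    !∣Δ↑h a y = subst (+ (a !) ∣ᶻ_) (sym (Δ↑-lift p a (pow q) y)) (∣-lift p _ (!∣D↑-pow a q) y)
    split : ∀ y → ∃ λ x → (D ↑ (m * p)) h y ≡ lift p ((D ↑ m) (pow q)) y +ᶻ + (p ^ suc e) *ᶻ x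
    split y = ∣-difference _ (subst (λ x → + (p ^ suc e) ∣ᶻ (D ↑ (m * p)) h y -ᶻ x)
      (Δ↑-lift p m (pow q) y) (D↑-mod m e v h m!≡ !∣Δ↑h y))
    -- The pointwise errors are collected into a sequence, to which D^r can then be applied.
    Y : Seq
    Y y = proj₁ (split y)

  -- Since (jp)^q = p^q j^q, subtracting p^q h(y) removes y^q exactly at the multiples of p. One
  -- formula thus covers both kinds of y.
  pow-approx : ∀ L q y → + (p ^ L) ∣ᶻ pow (pred p * p ^ L + q) y -ᶻ (pow q y +ᶻ -ᶻ + (p ^ q) *ᶻ lift p (pow q) y)
  pow-approx L q y = go (p ∣? y)
    where
    a = pred p * p ^ L
    go : Dec (p ∣ y) → + (p ^ L) ∣ᶻ pow (a + q) y -ᶻ (pow q y +ᶻ -ᶻ + (p ^ q) *ᶻ lift p (pow q) y)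
    go (yes (divides j refl)) = subst (+ (p ^ L) ∣ᶻ_) (sym eq)
      (ℤ∣.∣ᵤ⇒∣ (subst (p ^ L ∣_) (sym (^-distribˡ-+-* (j * p) a q)) (∣m⇒∣m*n ((j * p) ^ q) p^L∣y^a)))
      where
      solve₁ : ∀ x u v → x -ᶻ (u *ᶻ v +ᶻ -ᶻ v *ᶻ u) ≡ x
      solve₁ = solve-∀ᶻ
      eq : pow (a + q) (j * p) -ᶻ (pow q (j * p) +ᶻ -ᶻ + (p ^ q) *ᶻ lift p (pow q) (j * p)) ≡ pow (a + q) (j * p)
      eq = trans
        (cong₂ (λ u w → pow (a + q) (j * p) -ᶻ (u +ᶻ -ᶻ + (p ^ q) *ᶻ w))
          (trans (cong +_ (^-distrib-* j p q)) (ℤ.pos-* (j ^ q) (p ^ q))) (lift-* p (pow q) j))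
        (solve₁ _ (+ (j ^ q)) (+ (p ^ q)))
      L≤a : L ≤ a
      L≤a = ≤-trans (n≤m^n p L (nonTrivial⇒n>1 p))
        (m≤n*m (p ^ L) (pred p) {{pred≢0}})
      p^L∣y^a : p ^ L ∣ (j * p) ^ a
      p^L∣y^a = subst (p ^ L ∣_) (sym (^-distrib-* j p a)) (∣n⇒∣m*n (j ^ a) (∣-^ p L≤a))
    go (no p∤y) = subst (+ (p ^ L) ∣ᶻ_) (sym eq) (ℤ∣.∣m⇒∣m*n (+ (y ^ q)) p^L∣y^a-1)
      where
      solve₁ : ∀ x z n → x *ᶻ z -ᶻ (z +ᶻ n *ᶻ 0ℤ) ≡ (x -ᶻ 1ℤ) *ᶻ z
      solve₁ = solve-∀ᶻ
      eq : pow (a + q) y -ᶻ (pow q y +ᶻ -ᶻ + (p ^ q) *ᶻ lift p (pow q) y) ≡ (+ (y ^ a) -ᶻ 1ℤ) *ᶻ + (y ^ q)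
      eq = trans
        (cong₂ (λ u w → u -ᶻ (pow q y +ᶻ -ᶻ + (p ^ q) *ᶻ w))
          (trans (cong +_ (^-distribˡ-+-* y a q)) (ℤ.pos-* (y ^ a) (y ^ q))) (lift-∤ p (pow q) y p∤y))
        (solve₁ (+ (y ^ a)) (+ (y ^ q)) (-ᶻ + (p ^ q)))
      p^L∣y^a-1 : + (p ^ L) ∣ᶻ + (y ^ a) -ᶻ 1ℤ
      p^L∣y^a-1 = ℤ∣.∣-trans (ℤ∣.∣ᵤ⇒∣ (∣-^ p (n≤1+n L)))
        (subst (λ x → + (p ^ suc L) ∣ᶻ + x -ᶻ 1ℤ) (^-*-assoc y (pred p) (p ^ L))
          (lifting-exponent p (y ^ pred p) L (fermat y p∤y)))

  S-approx : ∀ L q m r e v → r < p → q < r + m * p → m ! ≡ p ^ e * v → ∃ λ y → ∃ λ x →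
             + ((r + m * p) ! * S (pred p * p ^ L + q) (r + m * p))
             ≡ -ᶻ + (p ^ q) *ᶻ ((-ᶻ 1ℤ) ^ᶻ r *ᶻ + (m ! * S q m) +ᶻ + (p ^ suc e) *ᶻ y) +ᶻ + (p ^ L) *ᶻ x
  S-approx L q m r e v r<p q<N m!≡ = y , (D ↑ N) X 0 , (begin
    + (N ! * S k N)
      ≡⟨ D↑-pow-0 N k ⟨
    (D ↑ N) (pow k) 0
      ≡⟨ cong-≗ (D↑-linear N) (λ y → proj₂ (split y)) 0 ⟩
    (D ↑ N) (λ y → (pow q y +ᶻ -ᶻ + (p ^ q) *ᶻ h y) +ᶻ + (p ^ L) *ᶻ X y) 0
      ≡⟨ comb (D↑-linear N) _ (+ (p ^ L)) X 0 ⟩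
    (D ↑ N) (λ y → pow q y +ᶻ -ᶻ + (p ^ q) *ᶻ h y) 0 +ᶻ + (p ^ L) *ᶻ (D ↑ N) X 0
      ≡⟨ cong (_+ᶻ + (p ^ L) *ᶻ (D ↑ N) X 0) (comb (D↑-linear N) (pow q) (-ᶻ + (p ^ q)) h 0) ⟩
    ((D ↑ N) (pow q) 0 +ᶻ -ᶻ + (p ^ q) *ᶻ (D ↑ N) h 0) +ᶻ + (p ^ L) *ᶻ (D ↑ N) X 0
      ≡⟨ cong₂ (λ u w → (u +ᶻ -ᶻ + (p ^ q) *ᶻ w) +ᶻ + (p ^ L) *ᶻ (D ↑ N) X 0)
           (trans (D↑-pow-0 N q) (cong +_ (trans (cong (N ! *_) (S≡0 q<N)) (*-zeroʳ (N !))))) eq ⟩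
    (0ℤ +ᶻ -ᶻ + (p ^ q) *ᶻ ((-ᶻ 1ℤ) ^ᶻ r *ᶻ + (m ! * S q m) +ᶻ + (p ^ suc e) *ᶻ y)) +ᶻ + (p ^ L) *ᶻ (D ↑ N) X 0
      ≡⟨ cong (_+ᶻ + (p ^ L) *ᶻ (D ↑ N) X 0) (ℤ.+-identityˡ
           (-ᶻ + (p ^ q) *ᶻ ((-ᶻ 1ℤ) ^ᶻ r *ᶻ + (m ! * S q m) +ᶻ + (p ^ suc e) *ᶻ y))) ⟩
    -ᶻ + (p ^ q) *ᶻ ((-ᶻ 1ℤ) ^ᶻ r *ᶻ + (m ! * S q m) +ᶻ + (p ^ suc e) *ᶻ y) +ᶻ + (p ^ L) *ᶻ (D ↑ N) X 0
      ∎)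
    where
    open ≡-Reasoning
    N = r + m * p
    k = pred p * p ^ L + q
    h = lift p (pow q)
    y = proj₁ (D↑-lift-pow q m r e v r<p m!≡)
    eq = proj₂ (D↑-lift-pow q m r e v r<p m!≡)
    split : ∀ y → ∃ λ x → pow k y ≡ (pow q y +ᶻ -ᶻ + (p ^ q) *ᶻ h y) +ᶻ + (p ^ L) *ᶻ x
    split y = ∣-difference (pow q y +ᶻ -ᶻ + (p ^ q) *ᶻ h y) (pow-approx L q y)
    X : Seq
    X y = proj₁ (split y)

  -- Here `s` stands for S(k, N) and `t` for S(q, m), with q = d + m, m! = p^e v, N! = p^m m! u and
  -- L = suc e + q + R. Cancelling p^(m + e) leaves u v s = p^d K with K ≡ ± v t modulo p, where u
  -- and v are prime to p.
  module Reduction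
    {d m e R u v s t : ℕ} (r : ℕ) (y x : ℤ) (p∤u : p ∤ u) (p∤v : p ∤ v)
    (eq : + (p ^ m * (p ^ e * v) * u * s)
        ≡ -ᶻ + (p ^ (d + m)) *ᶻ ((-ᶻ 1ℤ) ^ᶻ r *ᶻ + (p ^ e * v * t) +ᶻ + (p ^ suc e) *ᶻ y)
          +ᶻ + (p ^ (suc e + (d + m) + R)) *ᶻ x)
    where

    private
      σ W K : ℤ
      σ = (-ᶻ 1ℤ) ^ᶻ r
      W = + (p ^ R) *ᶻ x -ᶻ y
      K = -ᶻ (σ *ᶻ + (v * t)) +ᶻ + p *ᶻ W

      p∤uv : p ∤ u * v
      p∤uv = ∤-* p∤u p∤v

      p^[1+d]≡ : + (p ^ suc d) ≡ + (p ^ d) *ᶻ + p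
      p^[1+d]≡ = trans (cong +_ (*-comm p (p ^ d))) (ℤ.pos-* (p ^ d) p)

      p^L≡ : + (p ^ (suc e + (d + m) + R)) ≡ + (p ^ m * p ^ e) *ᶻ (+ (p ^ d) *ᶻ (+ p *ᶻ + (p ^ R)))
      p^L≡ = begin
        + (p ^ (suc e + (d + m) + R))
          ≡⟨ cong +_ (^-distribˡ-+-* p (suc e + (d + m)) R) ⟩
        + (p ^ (suc e + (d + m)) * p ^ R)
          ≡⟨ cong (λ z → + (z * p ^ R)) (^-distribˡ-+-* p (suc e) (d + m)) ⟩
        + (p ^ suc e * p ^ (d + m) * p ^ R)
          ≡⟨ cong (λ z → + (p ^ suc e * z * p ^ R)) (^-distribˡ-+-* p d m) ⟩
        + (p ^ suc e * (p ^ d * p ^ m) * p ^ R)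
          ≡⟨ cong +_ (solve₁ p (p ^ e) (p ^ d) (p ^ m) (p ^ R)) ⟩
        + (p ^ m * p ^ e * (p ^ d * (p * p ^ R)))
          ≡⟨ ℤ.pos-* (p ^ m * p ^ e) (p ^ d * (p * p ^ R)) ⟩
        + (p ^ m * p ^ e) *ᶻ + (p ^ d * (p * p ^ R))
          ≡⟨ cong (+ (p ^ m * p ^ e) *ᶻ_) (trans (ℤ.pos-* (p ^ d) (p * p ^ R)) (cong (+ (p ^ d) *ᶻ_) (ℤ.pos-* p (p ^ R)))) ⟩
        + (p ^ m * p ^ e) *ᶻ (+ (p ^ d) *ᶻ (+ p *ᶻ + (p ^ R)))
          ∎
        where
        open ≡-Reasoning
        solve₁ : ∀ p b c a r → p * b * (c * a) * r ≡ a * b * (c * (p * r))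
        solve₁ = solve-∀

      lhs≡ : + (p ^ m * (p ^ e * v) * u * s) ≡ + (p ^ m * p ^ e) *ᶻ + (u * v * s)
      lhs≡ = trans (cong +_ (solve₁ (p ^ m) (p ^ e) u v s)) (ℤ.pos-* (p ^ m * p ^ e) (u * v * s))
        where
        solve₁ : ∀ a b u v s → a * (b * v) * u * s ≡ a * b * (u * v * s)
        solve₁ = solve-∀

      -- The powers are abstracted to variables, so that the identity becomes one in a polynomial
      -- ring once the five equations are substituted.
      combine : ∀ {a b c p r σ w y x ab pb ca bw pl : ℤ} →
        ab ≡ a *ᶻ b → pb ≡ p *ᶻ b → ca ≡ c *ᶻ a → bw ≡ b *ᶻ w → pl ≡ ab *ᶻ (c *ᶻ (p *ᶻ r)) →
        -ᶻ ca *ᶻ (σ *ᶻ bw +ᶻ pb *ᶻ y) +ᶻ pl *ᶻ x ≡ ab *ᶻ (c *ᶻ (-ᶻ (σ *ᶻ w) +ᶻ p *ᶻ (r *ᶻ x -ᶻ y)))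
      combine {a} {b} {c} {p} {r} {σ} {w} {y} {x} refl refl refl refl refl = solve₁ a b c p r σ w y x
        where
        solve₁ : ∀ a b c p r σ w y x →
          -ᶻ (c *ᶻ a) *ᶻ (σ *ᶻ (b *ᶻ w) +ᶻ (p *ᶻ b) *ᶻ y) +ᶻ (a *ᶻ b *ᶻ (c *ᶻ (p *ᶻ r))) *ᶻ x
          ≡ a *ᶻ b *ᶻ (c *ᶻ (-ᶻ (σ *ᶻ w) +ᶻ p *ᶻ (r *ᶻ x -ᶻ y)))
        solve₁ = solve-∀ᶻ

      reduced : + (u * v * s) ≡ + (p ^ d) *ᶻ K
      reduced = ℤ.*-cancelˡ-≡ (+ (p ^ m * p ^ e)) (+ (u * v * s)) (+ (p ^ d) *ᶻ K) {{m*n≢0 (p ^ m) (p ^ e) {{m^n≢0 p m}} {{m^n≢0 p e}}}}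
        (trans (sym lhs≡) (trans eq (combine {a = + (p ^ m)} {+ (p ^ e)} {+ (p ^ d)} {+ p} {+ (p ^ R)} {σ} {+ (v * t)} {y} {x}
          (ℤ.pos-* (p ^ m) (p ^ e))
          (ℤ.pos-* p (p ^ e))
          (trans (cong +_ (^-distribˡ-+-* p d m)) (ℤ.pos-* (p ^ d) (p ^ m)))
          (trans (cong +_ (*-assoc (p ^ e) v t)) (ℤ.pos-* (p ^ e) (v * t)))
          p^L≡)))

      ∣K⇒ : + p ∣ᶻ K → + p ∣ᶻ + (v * t)
      ∣K⇒ p∣K = subst (+ p ∣ᶻ_) σσw≡w
        (ℤ∣.∣n⇒∣m*n (-ᶻ σ) (ℤ∣.∣m+n∣n⇒∣m {m = -ᶻ (σ *ᶻ + (v * t))} p∣K (ℤ∣.∣m⇒∣m*n W ℤ∣.∣-refl)))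
        where
        solve₁ : ∀ σ w → -ᶻ σ *ᶻ -ᶻ (σ *ᶻ w) ≡ (σ *ᶻ σ) *ᶻ w
        solve₁ = solve-∀ᶻ
        σσw≡w : -ᶻ σ *ᶻ -ᶻ (σ *ᶻ + (v * t)) ≡ + (v * t)
        σσw≡w = trans (solve₁ σ (+ (v * t))) (trans (cong (_*ᶻ + (v * t)) (sign-square r)) (ℤ.*-identityˡ (+ (v * t))))

      ⇒∣K : + p ∣ᶻ + (v * t) → + p ∣ᶻ K
      ⇒∣K d = ℤ∣.∣m∣n⇒∣m+n (ℤ∣.∣m⇒∣-m (ℤ∣.∣n⇒∣m*n σ d)) (ℤ∣.∣m⇒∣m*n W ℤ∣.∣-refl)

    p^d∣s : p ^ d ∣ s
    p^d∣s = ^∣-cancel d p∤uv (ℤ∣.∣⇒∣ᵤ {+ (p ^ d)} {+ (u * v * s)}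
      (dividesᶻ K (trans reduced (ℤ.*-comm (+ (p ^ d)) K))))

    p^[1+d]∣s⇔p∣t : p ^ suc d ∣ s ⇔ p ∣ t
    p^[1+d]∣s⇔p∣t = mk⇔
      (λ h → ∣-cancel p∤v (ℤ∣.∣⇒∣ᵤ {+ p} {+ (v * t)} (∣K⇒ (ℤ∣.*-cancelˡ-∣ (+ (p ^ d)) {+ p} {K} {{m^n≢0 p d}}
        (subst₂ _∣ᶻ_ p^[1+d]≡ reduced (ℤ∣.∣ᵤ⇒∣ {+ (p ^ suc d)} {+ (u * v * s)} (∣n⇒∣m*n (u * v) h)))))))
      (λ h → ^∣-cancel (suc d) p∤uv (ℤ∣.∣⇒∣ᵤ {+ (p ^ suc d)} {+ (u * v * s)} (subst₂ _∣ᶻ_ (sym p^[1+d]≡) (sym reduced)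
        (ℤ∣.*-monoʳ-∣ (+ (p ^ d)) (⇒∣K (ℤ∣.∣ᵤ⇒∣ {+ p} {+ (v * t)} (∣n⇒∣m*n v h)))))))

  S-divisibility : ∀ d m r → r < p → d + m < r + m * p → ∃ λ L₀ → ∀ L → L ≥ L₀ →
    let s = S (pred p * p ^ L + (d + m)) (r + m * p) in
    p ^ d ∣ s × (p ^ suc d ∣ s ⇔ p ∣ S (d + m) m)
  S-divisibility d m r r<p q<N with !-factorization m | !-divMod m r r<p
  -- The exponent of p in p · m! · p^q; from here on the error p^L x is absorbed.
  ... | mk! e v p∤v m!≡ _ | u , p∤u , N!≡ = suc e + (d + m) , main
    where
    main : ∀ L → L ≥ suc e + (d + m) →
      let s = S (pred p * p ^ L + (d + m)) (r + m * p) in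
      p ^ d ∣ s × (p ^ suc d ∣ s ⇔ p ∣ S (d + m) m)
    main L L≥L₀ with S-approx L (d + m) m r e v r<p q<N m!≡
    ... | y , x , eq = p^d∣s , p^[1+d]∣s⇔p∣t
      where
      s = S (pred p * p ^ L + (d + m)) (r + m * p)
      t = S (d + m) m
      N!≡′ : (r + m * p) ! ≡ p ^ m * (p ^ e * v) * u
      N!≡′ = trans N!≡ (cong (λ z → p ^ m * z * u) m!≡)
      eq′ : + (p ^ m * (p ^ e * v) * u * s)
          ≡ -ᶻ + (p ^ (d + m)) *ᶻ ((-ᶻ 1ℤ) ^ᶻ r *ᶻ + (p ^ e * v * t) +ᶻ + (p ^ suc e) *ᶻ y)
            +ᶻ + (p ^ (suc e + (d + m) + (L ∸ (suc e + (d + m))))) *ᶻ x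
      eq′ = trans (cong (λ z → + (z * s)) (sym N!≡′)) (trans eq
        (cong₂ (λ z l → -ᶻ + (p ^ (d + m)) *ᶻ ((-ᶻ 1ℤ) ^ᶻ r *ᶻ + (z * t) +ᶻ + (p ^ suc e) *ᶻ y) +ᶻ + (p ^ l) *ᶻ x)
          m!≡ (sym (m+[n∸m]≡n L≥L₀))))
      open Reduction {d} {m} {e} {L ∸ (suc e + (d + m))} {u} {v} {s} {t} r y x p∤u p∤v eq′

  ν-S : ∀ d m r → r < p → 1 ≤ r + m * p → d + m < r + m * p → ∃ λ L₀ → ∀ L → L ≥ L₀ →
    let s = S (pred p * p ^ L + (d + m)) (r + m * p) in
    ν p s ≥ d × (ν p s ≡ d ⇔ p ∤ S (d + m) m)
  -- N ≤ L gives N ≤ p^L ≤ k, hence S(k, N) > 0, so that `ν` is not taken at 0.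
  ν-S d m r r<p 1≤N q<N = L₀ ⊔ N , λ L L≥ →
    let h = proj₂ bound L (≤-trans (m≤m⊔n L₀ N) L≥)
        L≤k = ≤-trans (n≤m^n p L (nonTrivial⇒n>1 p)) (≤-trans (m≤n*m (p ^ L) (pred p) {{pred≢0}}) (m≤m+n _ (d + m)))
    in ν-exact p _ d _ {{p-nonTrivial}} {{>-nonZero (S>0 1≤N (≤-trans (m≤n⊔m L₀ N) (≤-trans L≥ L≤k)))}} (proj₁ h) (proj₂ h)
    where
    N = r + m * p
    bound = S-divisibility d m r r<p q<N
    L₀ = proj₁ bound
  ν-S-diagonal : ∀ n → 1 ≤ n → ∃ λ L₀ → ∀ L → L ≥ L₀ →
    ν p (S (pred p * p ^ L + n ∸ 1) n) ≡ pred p * (n / p) + n % p ∸ 1 ⇔ p ∤ S (n ∸ 1) (n / p)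
  ν-S-diagonal n 1≤n = proj₁ bound , λ L L≥ → subst₂ (λ k N → ν p (S k N) ≡ d ⇔ p ∤ S (n ∸ 1) m)
    (trans (cong (λ q → pred p * p ^ L + q) d+m≡) (sym (+-∸-assoc (pred p * p ^ L) 1≤n))) (sym n≡)
    (subst (λ q → ν p (S (pred p * p ^ L + (d + m)) (r + m * p)) ≡ d ⇔ p ∤ S q m) d+m≡ (proj₂ (proj₂ bound L L≥)))
    where
    m = n / p
    r = n % p
    d = pred p * m + r ∸ 1
    n≡ : n ≡ r + m * p
    n≡ = m≡m%n+[m/n]*n n p
    -- For n ≥ 1 the subtraction in `d` is not truncated, which yields d + m = n - 1.
    positive : ∀ m r → 1 ≤ r + m * p → 1 ≤ pred p * m + r
    positive m       (suc r) _ = ≤-trans (s≤s z≤n) (m≤n+m (suc r) (pred p * m))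
    positive (suc m) zero    _ = ≤-trans (>-nonZero⁻¹ _ {{m*n≢0 (pred p) (suc m) {{pred≢0}}}}) (m≤m+n _ 0)
    suc-d≡ : 1 + d ≡ pred p * m + r
    suc-d≡ = m+[n∸m]≡n (positive m r (subst (1 ≤_) n≡ 1≤n))
    suc-d+m≡ : 1 + (d + m) ≡ n
    suc-d+m≡ = begin
      1 + d + m              ≡⟨ cong (_+ m) suc-d≡ ⟩
      pred p * m + r + m     ≡⟨ solve₁ (pred p) m r ⟩
      r + m * suc (pred p)   ≡⟨ cong (λ x → r + m * x) (suc-pred p) ⟩
      r + m * p              ≡⟨ n≡ ⟨
      n                      ∎
      where
      open ≡-Reasoning
      solve₁ : ∀ e m r → e * m + r + m ≡ r + m * (1 + e)
      solve₁ = solve-∀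
    d+m≡ : d + m ≡ n ∸ 1
    d+m≡ = cong (_∸ 1) suc-d+m≡
    bound = ν-S d m r (m%n<n n p) (subst (1 ≤_) n≡ 1≤n) (≤-reflexive (trans suc-d+m≡ n≡))

-- The primes 2 and 3

[r+m*n]/n≡m : ∀ r m n .{{_ : NonZero n}} → r < n → (r + m * n) / n ≡ m
[r+m*n]/n≡m r m n r<n = begin
  (r + m * n) / n        ≡⟨ +-distrib-/-∣ʳ r (n∣m*n m) ⟩
  r / n + m * n / n      ≡⟨ cong₂ _+_ (m<n⇒m/n≡0 r<n) (m*n/n≡m m n) ⟩
  m                      ∎
  where open ≡-Reasoning

-- With E the shift, (E - 1)² = (E² - 1) - 2(E - 1).
D↑2 : ∀ f → (D ↑ 2) f ≗ λ y → Δ 2 f y +ᶻ -ᶻ + 2 *ᶻ D-after 0 f y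
D↑2 f y = solve₁ (f (2 + y)) (f (1 + y)) (f y)
  where
  solve₁ : ∀ a b c → (a -ᶻ b) -ᶻ (b -ᶻ c) ≡ (a -ᶻ c) +ᶻ -ᶻ + 2 *ᶻ (b -ᶻ c)
  solve₁ = solve-∀ᶻ

-- With E the shift, (E - 1)³ = (E³ - 1) - 3E(E - 1); the factor E is the offset 1.
D↑3 : ∀ f → (D ↑ 3) f ≗ λ y → Δ 3 f y +ᶻ -ᶻ + 3 *ᶻ D-after 1 f y
D↑3 f y = solve₁ (f (3 + y)) (f (2 + y)) (f (1 + y)) (f y)
  where
  solve₁ : ∀ a b c d → ((a -ᶻ b) -ᶻ (b -ᶻ c)) -ᶻ ((b -ᶻ c) -ᶻ (c -ᶻ d)) ≡ (a -ᶻ d) +ᶻ -ᶻ + 3 *ᶻ (b -ᶻ c)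
  solve₁ = solve-∀ᶻ

pos-r+m*n : ∀ r m n → + (r + m * n) ≡ + r +ᶻ + m *ᶻ + n
pos-r+m*n r m n = trans (ℤ.pos-+ r (m * n)) (cong (+ r +ᶻ_) (ℤ.pos-* m n))

fermat₂ : ∀ y → 2 ∤ y → + 2 ∣ᶻ + (y ^ 1) -ᶻ 1ℤ
fermat₂ y 2∤y with y divMod 2
... | result m zero       refl = contradiction (n∣m*n m) 2∤y
... | result m (suc zero) refl = dividesᶻ (+ m)
  (trans (cong (λ x → + x -ᶻ 1ℤ) (*-identityʳ (1 + m * 2))) (trans (cong (_-ᶻ 1ℤ) (pos-r+m*n 1 m 2)) (solve₁ (+ m))))
  where
  solve₁ : ∀ m → (1ℤ +ᶻ m *ᶻ + 2) -ᶻ 1ℤ ≡ m *ᶻ + 2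
  solve₁ = solve-∀ᶻ

fermat₃ : ∀ y → 3 ∤ y → + 3 ∣ᶻ + (y ^ 2) -ᶻ 1ℤ
fermat₃ y 3∤y with y divMod 3
... | result m zero             refl = contradiction (n∣m*n m) 3∤y
... | result m (suc zero)       refl = dividesᶻ (+ (m * (2 + m * 3)))
  (trans (cong (λ x → + x -ᶻ 1ℤ) (solve₁ m)) (trans (cong (_-ᶻ 1ℤ) (pos-r+m*n 1 (m * (2 + m * 3)) 3)) (solve₂ (+ (m * (2 + m * 3))))))
  where
  solve₁ : ∀ m → (1 + m * 3) * ((1 + m * 3) * 1) ≡ 1 + m * (2 + m * 3) * 3
  solve₁ = solve-∀
  solve₂ : ∀ m → (1ℤ +ᶻ m *ᶻ + 3) -ᶻ 1ℤ ≡ m *ᶻ + 3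
  solve₂ = solve-∀ᶻ
... | result m (suc (suc zero)) refl = dividesᶻ (+ ((1 + m) * (1 + m * 3)))
  (trans (cong (λ x → + x -ᶻ 1ℤ) (solve₁ m)) (trans (cong (_-ᶻ 1ℤ) (pos-r+m*n 1 ((1 + m) * (1 + m * 3)) 3)) (solve₂ (+ ((1 + m) * (1 + m * 3))))))
  where
  solve₁ : ∀ m → (2 + m * 3) * ((2 + m * 3) * 1) ≡ 1 + (1 + m) * (1 + m * 3) * 3
  solve₁ = solve-∀
  solve₂ : ∀ m → (1ℤ +ᶻ m *ᶻ + 3) -ᶻ 1ℤ ≡ m *ᶻ + 3
  solve₂ = solve-∀ᶻ

module Valuation₂ = Valuation 2 0 2-prime D↑2 fermat₂
module Valuation₃ = Valuation 3 1 3-prime D↑3 fermat₃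

-- The criterion for p = 2

module _ where
  open Binary

  -- In the first three constructors the parameter is the s of n = 2^ε(2s + 1); `eight` collects all
  -- positive multiples of 8, where the Stirling number is even.
  data TwoPart : ℕ → Set where
    odd   : ∀ m → TwoPart (1 + m * 2)
    twice : ∀ c → TwoPart (2 + c * 4)
    four  : ∀ s → TwoPart (4 + s * 8)
    eight : ∀ s → TwoPart (8 + s * 8)

  twoPart : ∀ n → 1 ≤ n → TwoPart n
  twoPart n 1≤n with n divMod 2
  ... | result m (suc zero) refl = odd m
  ... | result m zero refl with m divMod 2
  ...   | result c (suc zero) refl = subst TwoPart (solve₁ c) (twice c)
    where
    solve₁ : ∀ c → 2 + c * 4 ≡ (1 + c * 2) * 2
    solve₁ = solve-∀
  ...   | result c zero refl with c divMod 2
  ...     | result s (suc zero) refl = subst TwoPart (solve₁ s) (four s)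
    where
    solve₁ : ∀ s → 4 + s * 8 ≡ (1 + s * 2) * 2 * 2
    solve₁ = solve-∀
  ...     | result (suc s) zero refl = subst TwoPart (solve₁ s) (eight s)
    where
    solve₁ : ∀ s → 8 + s * 8 ≡ (2 + s * 2) * 2 * 2
    solve₁ = solve-∀

  2∤S-odd⇔ : ∀ m → 2 ∤ S (m * 2) ((1 + m * 2) / 2) ⇔ 2 ∤ ((3 * m) C m)
  2∤S-odd⇔ m = subst (λ j → 2 ∤ S (m * 2) j ⇔ 2 ∤ ((3 * m) C m)) (sym ([r+m*n]/n≡m 1 m 2 ≤-refl)) (2∤S[2m,m]⇔ m)

  2∤S-twice⇔ : ∀ c → 2 ∤ S (1 + c * 4) ((2 + c * 4) / 2) ⇔ 2 ∤ ((3 * c) C c)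
  2∤S-twice⇔ c = subst (λ j → 2 ∤ S (1 + c * 4) j ⇔ 2 ∤ ((3 * c) C c))
    (sym (trans (cong (_/ 2) (solve₁ c)) (m*n/n≡m (1 + c * 2) 2))) (2∤S[4c+1,2c+1]⇔ c)
    where
    solve₁ : ∀ c → 2 + c * 4 ≡ (1 + c * 2) * 2
    solve₁ = solve-∀

  2∤S-four⇔ : ∀ s → 2 ∤ S (3 + s * 8) ((4 + s * 8) / 2) ⇔ 2 ∤ ((3 * s) C s)
  2∤S-four⇔ s = subst (λ j → 2 ∤ S (3 + s * 8) j ⇔ 2 ∤ ((3 * s) C s))
    (sym (trans (cong (_/ 2) (solve₁ s)) (m*n/n≡m (2 + s * 4) 2))) (2∤S[8s+3,4s+2]⇔ s)
    where
    solve₁ : ∀ s → 4 + s * 8 ≡ (2 + s * 4) * 2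
    solve₁ = solve-∀

  2∣S-eight : ∀ s → 2 ∣ S (7 + s * 8) ((8 + s * 8) / 2)
  2∣S-eight s = subst (λ j → 2 ∣ S (7 + s * 8) j)
    (sym (trans (cong (_/ 2) (solve₁ s)) (m*n/n≡m (4 + s * 4) 2))) (2∣S[8s+7,4s+4] s)
    where
    solve₁ : ∀ s → 8 + s * 8 ≡ (4 + s * 4) * 2
    solve₁ = solve-∀

  OddStirling : ℕ → Set
  OddStirling n = ∃ λ ε → ∃ λ s → ε ≤ 2 × n ≡ 2 ^ ε * (2 * s + 1) × 2 ∤ ((3 * s) C s)

  2∤S⇔ : ∀ n → 1 ≤ n → 2 ∤ S (n ∸ 1) (n / 2) ⇔ OddStirling n
  2∤S⇔ n 1≤n = mk⇔ (λ h → ⇒ (twoPart n 1≤n) h) ⇐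
    where
    solve₀ : ∀ s → 1 + s * 2 ≡ 1 * (2 * s + 1)
    solve₀ = solve-∀
    solve₁ : ∀ s → 2 + s * 4 ≡ 2 * (2 * s + 1)
    solve₁ = solve-∀
    solve₂ : ∀ s → 4 + s * 8 ≡ 4 * (2 * s + 1)
    solve₂ = solve-∀
    ⇒ : ∀ {n} → TwoPart n → 2 ∤ S (n ∸ 1) (n / 2) → OddStirling n
    ⇒ (odd m)   h = 0 , m , z≤n , solve₀ m , to (2∤S-odd⇔ m) h
    ⇒ (twice c) h = 1 , c , s≤s z≤n , solve₁ c , to (2∤S-twice⇔ c) h
    ⇒ (four s)  h = 2 , s , ≤-refl , solve₂ s , to (2∤S-four⇔ s) h
    ⇒ (eight s) h = contradiction (2∣S-eight s) h
    ⇐ : OddStirling n → 2 ∤ S (n ∸ 1) (n / 2)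
    ⇐ (0 , s , _ , n≡ , h) = subst (λ n → 2 ∤ S (n ∸ 1) (n / 2)) (trans (solve₀ s) (sym n≡)) (from (2∤S-odd⇔ s) h)
    ⇐ (1 , s , _ , n≡ , h) = subst (λ n → 2 ∤ S (n ∸ 1) (n / 2)) (trans (solve₁ s) (sym n≡)) (from (2∤S-twice⇔ s) h)
    ⇐ (2 , s , _ , n≡ , h) = subst (λ n → 2 ∤ S (n ∸ 1) (n / 2)) (trans (solve₂ s) (sym n≡)) (from (2∤S-four⇔ s) h)
    ⇐ (suc (suc (suc _)) , _ , s≤s (s≤s ()) , _)

-- The criteria for p = 3

module _ where
  open Ternary

  Exceptional : ℕ → Set
  Exceptional n = n ∈ affine 3 T 1 ∪ affine 3 T′ 2 ∪ affine 9 T 3 × ¬ (n % 9 ≡ 2)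

  n≡2+k*9 : ∀ {n} → n % 9 ≡ 2 → n ≡ 2 + (n / 9) * 3 * 3
  n≡2+k*9 {n} n%9≡2 = trans (m≡m%n+[m/n]*n n 9) (cong₂ _+_ n%9≡2 (sym (*-assoc (n / 9) 3 3)))

  r≢2⇒%9≢2 : ∀ r m → r < 3 → r ≢ 2 → (r + m * 3) % 9 ≢ 2
  r≢2⇒%9≢2 r m r<3 r≢2 %9≡2 = r≢2 (begin
    r                                           ≡⟨ m<n⇒m%n≡m r<3 ⟨
    r % 3                                       ≡⟨ [m+kn]%n≡m%n r m 3 ⟨
    (r + m * 3) % 3                             ≡⟨ cong (_% 3) (n≡2+k*9 {r + m * 3} %9≡2) ⟩
    (2 + (r + m * 3) / 9 * 3 * 3) % 3           ≡⟨ [m+kn]%n≡m%n 2 ((r + m * 3) / 9 * 3) 3 ⟩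
    2                                           ∎)
    where open ≡-Reasoning

  m%3≡1⇒%9≢2 : ∀ m → m % 3 ≡ 1 → (2 + m * 3) % 9 ≢ 2
  m%3≡1⇒%9≢2 m m%3≡1 %9≡2 = contradiction (begin
    1                                           ≡⟨ m%3≡1 ⟨
    m % 3                                       ≡⟨ cong (_% 3) (*-cancelʳ-≡ m ((2 + m * 3) / 9 * 3) 3 (+-cancelˡ-≡ 2 _ _ (n≡2+k*9 {2 + m * 3} %9≡2))) ⟩
    ((2 + m * 3) / 9 * 3) % 3                   ≡⟨ [m+kn]%n≡m%n 0 ((2 + m * 3) / 9) 3 ⟩
    0                                           ∎) (λ ())
    where open ≡-Reasoning

  -- For n = 3m + 2 the set T′ excludes m ≡ 2 modulo 3, and n ≢ 2 modulo 9 excludes m ≡ 0. What is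
  -- left, m ≡ 1, is the only residue for which S(3m + 1, m) can be prime to 3.
  %9≢2⇒m%3≡1 : ∀ m → m % 3 ≢ 2 → (2 + m * 3) % 9 ≢ 2 → m % 3 ≡ 1
  %9≢2⇒m%3≡1 m m%3≢2 %9≢2 with m divMod 3
  ... | result k zero             refl = contradiction
    (trans (cong (λ x → (2 + x) % 9) (*-assoc k 3 3)) ([m+kn]%n≡m%n 2 k 9)) %9≢2
  ... | result k (suc zero)       refl = [m+kn]%n≡m%n 1 k 3
  ... | result k (suc (suc zero)) refl = contradiction ([m+kn]%n≡m%n 2 k 3) m%3≢2

  Regular : ℕ → Set
  Regular n = 3 ∤ S (n ∸ 1) (n / 3)

  regular₁⇔ : ∀ m → Regular (1 + m * 3) ⇔ T m
  regular₁⇔ m = subst (λ j → 3 ∤ S (m * 3) j ⇔ T m) (sym ([r+m*n]/n≡m 1 m 3 (s≤s (s≤s z≤n)))) (3∤S[3m,m]⇔ m)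

  regular₂⇔ : ∀ m → Regular (2 + m * 3) ⇔ (T m × m % 3 ≡ 1)
  regular₂⇔ m = subst (λ j → 3 ∤ S (1 + m * 3) j ⇔ (T m × m % 3 ≡ 1)) (sym ([r+m*n]/n≡m 2 m 3 ≤-refl)) (3∤S[3m+1,m]⇔ m)

  regular₃⇔ : ∀ m → Regular (3 + m * 3) ⇔ (∃ λ t → T t × m ≡ t * 3)
  regular₃⇔ m = subst (λ j → 3 ∤ S (2 + m * 3) j ⇔ (∃ λ t → T t × m ≡ t * 3)) (sym (m*n/n≡m (suc m) 3)) (3∤S[3m+2,m+1]⇔ m)

  affine₁ : ∀ t → 1 + t * 3 ≡ 3 * t + 1
  affine₁ = solve-∀

  affine₂ : ∀ t → 2 + t * 3 ≡ 3 * t + 2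
  affine₂ = solve-∀

  affine₃ : ∀ t → 3 + t * 3 * 3 ≡ 9 * t + 3
  affine₃ = solve-∀

  regular⇒exceptional : ∀ {n} → 1 ≤ n → DivMod n 3 → Regular n → Exceptional n
  regular⇒exceptional _ (result m (suc zero) refl) h =
    inj₁ (m , to (regular₁⇔ m) h , affine₁ m) , r≢2⇒%9≢2 1 m (s≤s (s≤s z≤n)) (λ ())
  regular⇒exceptional _ (result m (suc (suc zero)) refl) h with to (regular₂⇔ m) h
  ... | Tm , m%3≡1 =
    inj₂ (inj₁ (m , (Tm , λ m%3≡2 → contradiction (trans (sym m%3≡1) m%3≡2) (λ ())) , affine₂ m)) , m%3≡1⇒%9≢2 m m%3≡1
  regular⇒exceptional _ (result (suc m) zero refl) h with to (regular₃⇔ m) h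
  ... | t , Tt , m≡ =
    inj₂ (inj₂ (t , Tt , trans (cong (λ x → 3 + x * 3) m≡) (affine₃ t))) , r≢2⇒%9≢2 0 (suc m) (s≤s z≤n) (λ ())

  exceptional⇒regular : ∀ n → Exceptional n → Regular n
  exceptional⇒regular n (inj₁ (t , Tt , n≡) , _) = subst Regular (trans (affine₁ t) (sym n≡)) (from (regular₁⇔ t) Tt)
  exceptional⇒regular n (inj₂ (inj₁ (t , (Tt , t%3≢2) , n≡)) , n%9≢2) = subst Regular eq
    (from (regular₂⇔ t) (Tt , %9≢2⇒m%3≡1 t t%3≢2 (subst (λ x → x % 9 ≢ 2) (sym eq) n%9≢2)))
    where eq = trans (affine₂ t) (sym n≡)
  exceptional⇒regular n (inj₂ (inj₂ (t , Tt , n≡)) , _) =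
    subst Regular (trans (affine₃ t) (sym n≡)) (from (regular₃⇔ (t * 3)) (t , Tt , refl))

  3∤S⇔ : ∀ n → 1 ≤ n → Regular n ⇔ Exceptional n
  3∤S⇔ n 1≤n = mk⇔ (regular⇒exceptional 1≤n (n divMod 3)) (exceptional⇒regular n)

  ν₃-S[n+1] : ∀ x → ∃ λ L₀ → ∀ L → L ≥ L₀ → ∀ n → n ≡ 9 * x + 2 →
    ν 3 (S (2 * 3 ^ L + n ∸ 1) (n + 1)) ≥ 6 * x × (ν 3 (S (2 * 3 ^ L + n ∸ 1) (n + 1)) ≡ 6 * x ⇔ x ∈ T)
  ν₃-S[n+1] x = proj₁ bound , λ L L≥ n n≡ → subst₂
    (λ k N → ν 3 (S k N) ≥ 6 * x × (ν 3 (S k N) ≡ 6 * x ⇔ x ∈ T)) (k≡ L n≡) (N≡ n≡)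
    (proj₁ (proj₂ bound L L≥) , ⇔-trans (proj₂ (proj₂ bound L L≥)) 3∤⇔T)
    where
    q<N : 6 * x + (1 + x * 3) < (1 + x * 3) * 3
    q<N = ≤-trans (≤-reflexive (solve₁ x)) (n≤1+n (2 + x * 3 * 3))
      where
      solve₁ : ∀ x → 1 + (6 * x + (1 + x * 3)) ≡ 2 + x * 3 * 3
      solve₁ = solve-∀
    -- N = 3(3x + 1) with remainder 0, and q = 6x + (3x + 1) is N - 2, one less than in
    -- `ν-S-diagonal`.
    bound = Valuation₃.ν-S (6 * x) (1 + x * 3) 0 (s≤s z≤n) (s≤s z≤n) q<N
    q≡ : ∀ x → 6 * x + (1 + x * 3) ≡ 1 + x * 9
    q≡ = solve-∀
    3∤⇔T : 3 ∤ S (6 * x + (1 + x * 3)) (1 + x * 3) ⇔ T x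
    3∤⇔T = subst (λ q → 3 ∤ S q (1 + x * 3) ⇔ T x) (sym (q≡ x)) (3∤S[9t+1,3t+1]⇔ x)
    k≡ : ∀ L {n} → n ≡ 9 * x + 2 → 2 * 3 ^ L + (6 * x + (1 + x * 3)) ≡ 2 * 3 ^ L + n ∸ 1
    k≡ L refl = cong (_∸ 1) (solve₁ (2 * 3 ^ L) x)
      where
      solve₁ : ∀ a x → 1 + (a + (6 * x + (1 + x * 3))) ≡ a + (9 * x + 2)
      solve₁ = solve-∀
    N≡ : ∀ {n} → n ≡ 9 * x + 2 → (1 + x * 3) * 3 ≡ n + 1
    N≡ refl = solve₁ x
      where
      solve₁ : ∀ x → (1 + x * 3) * 3 ≡ 9 * x + 2 + 1
      solve₁ = solve-∀

-- Assembly of the three parts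

[9x+2]/9≡x : ∀ {n} x → n ≡ 9 * x + 2 → n / 9 ≡ x
[9x+2]/9≡x x refl = trans (cong (_/ 9) (solve₁ x)) ([r+m*n]/n≡m 2 x 9 (s≤s (s≤s (s≤s z≤n))))
  where
  solve₁ : ∀ x → 9 * x + 2 ≡ 2 + x * 9
  solve₁ = solve-∀

mainTheorem3 : (n : ℕ) → n ≥ 1 → ∃ λ (L₀ : ℕ) → (L : ℕ) → L ≥ L₀ →
    ( ν 2 (S (2 ^ L + n ∸ 1) n) ≡ n / 2 + n % 2 ∸ 1
    ⇔ (∃ λ (ε : ℕ) → ∃ λ (s : ℕ) →
    ε ≤ 2 × n ≡ 2 ^ ε * (2 * s + 1) × 2 ∤ ((3 * s) C s)) )
    × ( ν 3 (S (2 * 3 ^ L + n ∸ 1) n) ≡ 2 * (n / 3) + n % 3 ∸ 1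
    ⇔ (n ∈ affine 3 T 1 ∪ affine 3 T′ 2 ∪ affine 9 T 3
    × ¬ (n % 9 ≡ 2)) )
    × ( (x : ℕ) → n ≡ 9 * x + 2 →
    ν 3 (S (2 * 3 ^ L + n ∸ 1) (n + 1)) ≥ 6 * x
    × ( ν 3 (S (2 * 3 ^ L + n ∸ 1) (n + 1)) ≡ 6 * x ⇔ x ∈ T ) )
mainTheorem3 n n≥1 = L₁ ⊔ (L₂ ⊔ L₃) , λ L L≥ →
    part-i L (≤-trans (m≤m⊔n L₁ _) L≥)
  , ⇔-trans (proj₂ bound₂ L (≤-trans (≤-trans (m≤m⊔n L₂ L₃) (m≤n⊔m L₁ _)) L≥)) (3∤S⇔ n n≥1)
  , λ { x n≡ → part-iii L (≤-trans (≤-trans (m≤n⊔m L₂ L₃) (m≤n⊔m L₁ _)) L≥) x n≡ ([9x+2]/9≡x x n≡) }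
  where
  bound₁ = Valuation₂.ν-S-diagonal n n≥1
  bound₂ = Valuation₃.ν-S-diagonal n n≥1
  -- The bound on L is fixed before x is given, but x can only be [n/9]; for n not of the form 9x +
  -- 2 part (iii) is vacuous.
  bound₃ = ν₃-S[n+1] (n / 9)
  L₁ = proj₁ bound₁
  L₂ = proj₁ bound₂
  L₃ = proj₁ bound₃
  part-i : ∀ L → L ≥ L₁ → ν 2 (S (2 ^ L + n ∸ 1) n) ≡ n / 2 + n % 2 ∸ 1 ⇔ OddStirling n
  -- For p = 2 the factor p - 1 of the general formula is 1 and is removed in both places.
  part-i L L≥ = subst₂ (λ a b → ν 2 (S (a + n ∸ 1) n) ≡ b + n % 2 ∸ 1 ⇔ OddStirling n)
    (*-identityˡ (2 ^ L)) (*-identityˡ (n / 2)) (⇔-trans (proj₂ bound₁ L L≥) (2∤S⇔ n n≥1))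
  part-iii : ∀ L → L ≥ L₃ → ∀ x → n ≡ 9 * x + 2 → n / 9 ≡ x →
    ν 3 (S (2 * 3 ^ L + n ∸ 1) (n + 1)) ≥ 6 * x
    × ( ν 3 (S (2 * 3 ^ L + n ∸ 1) (n + 1)) ≡ 6 * x ⇔ x ∈ T )
  part-iii L L≥ x n≡ refl = proj₂ bound₃ L L≥ n n≡
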